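{- Let $q$ be a power of a prime $p$, let $g\ge 1$, let $D=\mathbf{Z}_q^{2g}$ with its standard symplectic form $\omega$, and let $F_0$ be a $p$-autodual $\sigma$-semilinear endomorphism of $D$. Then the double coset $\mathcal{F}(D)=\mathrm{Sp}(D)\,F_0\,\mathrm{Sp}(D)$ is exactly the set of all $p$-autodual $\sigma$-semilinear endomorphisms of $D$.
   Context: Let $\mathbf{Z}_q=W(\mathbf{F}_q)$ be the ring of Witt vectors of $\mathbf{F}_q$, with $\sigma:\mathbf{Z}_q\to\mathbf{Z}_q$ the lift of the $p$-power Frobenius of $\mathbf{F}_q$. The form $\omega$ is the perfect alternating $\mathbf{Z}_q$-bilinear form on $D=\mathbf{Z}_q^{2g}$ corresponding to the standard (symplectic) basis $e_1,\dots,e_{2g}$. A $\sigma$-semilinear endomorphism $F:D\to D$ (additive with $F(\lambda x)=\sigma(\lambda)F(x)$) is called $p$-autodual if there exists a $\sigma^{ -1}$-semilinear endomorphism $V:D\to D$ such that $FV=VF=p$ and $\omega(Fx,y)=\sigma(\omega(x,Vy))$ for all $x,y\in D$. $\mathrm{Sp}(D)$ is the group of $\mathbf{Z}_q$-linear automorphisms of $D$ preserving $\omega$, and $\mathrm{Sp}(D)F_0\mathrm{Sp}(D)=\{hF_0h' : h,h'\in \mathrm{Sp}(D)\}$. -}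

module Defs where

open import Algebra.Bundles using (RawRing; CommutativeRing)
open import Algebra.Module.Bundles using (LeftModule)
open import Algebra.Module.Morphism.Structures using (module LeftModuleMorphisms)
open import Algebra.Definitions using (Congruent₁; Congruent₂)
open import Data.Fin.Base 
  using (Fin; zero; suc; toℕ; fromℕ; fromℕ<; inject₁; combine; remQuot; _↑ˡ_; _↑ʳ_)
open import Data.Fin.Patterns using (0F; 1F; 2F)
open import Data.Fin.Properties using (toℕ<n; toℕ-fromℕ; toℕ-fromℕ<; toℕ-inject₁; remQuot-combine)
open import Data.Integer.Base as ℤ using (ℤ)
import Data.Integer.Properties as ℤ
open import Data.List.Base using (List; []; _∷_; map)
open import Data.List.Relation.Unary.All as All using (All; []; _∷_)
open import Data.Nat.Base as ℕ using (ℕ; zero; suc; _!)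
open import Data.Nat.Combinatorics using (_C_; nCn≡1; nCk≡n!/k![n-k]!; k![n∸k]!∣n!)
open import Data.Nat.Divisibility using (_∣_; quotient; ∣1⇒≡1; ∣⇒≤; m∣m*n)
open import Data.Nat.DivMod using (m/n*n≡m)
open import Data.Nat.Primality using (Prime; prime⇒nonZero; euclidsLemma; ¬prime[0]; ¬prime[1])
open import Data.Nat.Properties as ℕ using (_!*_!≢0)
open import Data.Product.Base as Product using (_×_; _,_; proj₁; proj₂; ∃; ∃₂)
open import Data.Sum.Base as Sum using (inj₁; inj₂)
open import Data.Vec.Functional using (Vector)
open import Function.Base using (_∘_; id)
open import Function.Bundles using (Inverse)
open import Level using (Level; 0ℓ; _⊔_)
open import Relation.Binary.Structures using (IsEquivalence)
open import Relation.Nullary.Negation using (¬_; contradiction)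
open import Relation.Binary.PropositionalEquality as ≡ using (_≡_; _≢_)

private variable
  c ℓ c′ ℓ′ : Level
  Var′ Var : Set

infixl 6 _:+_
infixl 7 _:*_
infix  8 :-_

-- Integer polynomials are represented by ring expressions, compared by _≐_ below.
data Poly (Var : Set) : Set where
  var       : Var → Poly Var
  :0 :1     : Poly Var
  _:+_ _:*_ : Poly Var → Poly Var → Poly Var
  :-_       : Poly Var → Poly Var

module Evaluation (R : RawRing c ℓ) where
  open RawRing R

  ⟦_⟧ : Poly Var → (Var → Carrier) → Carrier
  ⟦ var v  ⟧ ρ = ρ v
  ⟦ :0     ⟧ ρ = 0#
  ⟦ :1     ⟧ ρ = 1#
  ⟦ f :+ g ⟧ ρ = ⟦ f ⟧ ρ + ⟦ g ⟧ ρ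
  ⟦ f :* g ⟧ ρ = ⟦ f ⟧ ρ * ⟦ g ⟧ ρ
  ⟦ :- f   ⟧ ρ = - ⟦ f ⟧ ρ

  horner : Carrier → List Carrier → Carrier
  horner x []       = 0#
  horner x (a ∷ as) = a + x * horner x as

open Evaluation using (⟦_⟧; horner)

⟦_⟧ℤ : Poly Var → (Var → ℤ) → ℤ
⟦_⟧ℤ = ⟦_⟧ ℤ.+-*-rawRing

-- Two expressions denote the same polynomial with integer coefficients iff they agree at all
-- integer points, because ℤ is an infinite domain.
infix 4 _≐_
record _≐_ {Var : Set} (f g : Poly Var) : Set where
  constructor pointwise
  field
    at : ∀ ρ → ⟦ f ⟧ℤ ρ ≡ ⟦ g ⟧ℤ ρ

open _≐_

ℤ[_] : Set → CommutativeRing 0ℓ 0ℓ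
ℤ[ Var ] = record
  { Carrier = Poly Var
  ; _≈_     = _≐_
  ; _+_     = _:+_
  ; _*_     = _:*_
  ; -_      = :-_
  ; 0#      = :0
  ; 1#      = :1
  ; isCommutativeRing = record
    { isRing = record
      { +-isAbelianGroup = record
        { isGroup = record
          { isMonoid = record
            { isSemigroup = record
              { isMagma = record
                { isEquivalence = record
                  { refl  = pointwise λ ρ → ≡.refl
                  ; sym   = λ e → pointwise λ ρ → ≡.sym (at e ρ)
                  ; trans = λ e e′ → pointwise λ ρ → ≡.trans (at e ρ) (at e′ ρ)
                  }
                ; ∙-cong = λ e e′ → pointwise λ ρ → ≡.cong₂ ℤ._+_ (at e ρ) (at e′ ρ)
                }
              ; assoc = λ f g h → pointwise λ ρ → ℤ.+-assoc (⟦ f ⟧ℤ ρ) (⟦ g ⟧ℤ ρ) (⟦ h ⟧ℤ ρ)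
              }
            ; identity = (λ f → pointwise λ ρ → ℤ.+-identityˡ (⟦ f ⟧ℤ ρ))
                       , (λ f → pointwise λ ρ → ℤ.+-identityʳ (⟦ f ⟧ℤ ρ))
            }
          ; inverse = (λ f → pointwise λ ρ → ℤ.+-inverseˡ (⟦ f ⟧ℤ ρ))
                    , (λ f → pointwise λ ρ → ℤ.+-inverseʳ (⟦ f ⟧ℤ ρ))
          ; ⁻¹-cong = λ e → pointwise λ ρ → ≡.cong (ℤ.-_) (at e ρ)
          }
        ; comm = λ f g → pointwise λ ρ → ℤ.+-comm (⟦ f ⟧ℤ ρ) (⟦ g ⟧ℤ ρ)
        }
      ; *-cong     = λ e e′ → pointwise λ ρ → ≡.cong₂ ℤ._*_ (at e ρ) (at e′ ρ)
      ; *-assoc    = λ f g h → pointwise λ ρ → ℤ.*-assoc (⟦ f ⟧ℤ ρ) (⟦ g ⟧ℤ ρ) (⟦ h ⟧ℤ ρ)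
      ; *-identity = (λ f → pointwise λ ρ → ℤ.*-identityˡ (⟦ f ⟧ℤ ρ))
                   , (λ f → pointwise λ ρ → ℤ.*-identityʳ (⟦ f ⟧ℤ ρ))
      ; distrib    = (λ f g h → pointwise λ ρ → ℤ.*-distribˡ-+ (⟦ f ⟧ℤ ρ) (⟦ g ⟧ℤ ρ) (⟦ h ⟧ℤ ρ))
                   , (λ f g h → pointwise λ ρ → ℤ.*-distribʳ-+ (⟦ f ⟧ℤ ρ) (⟦ g ⟧ℤ ρ) (⟦ h ⟧ℤ ρ))
      }
    ; *-comm = λ f g → pointwise λ ρ → ℤ.*-comm (⟦ f ⟧ℤ ρ) (⟦ g ⟧ℤ ρ)
    }
  }

-- A homomorphism of raw rings, together with the congruence laws of its target; the latter are
-- bundled because the target need not yet be known to be a ring.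
record RawHom (R : RawRing c ℓ) (S : RawRing c′ ℓ′) : Set (c ⊔ c′ ⊔ ℓ′) where
  private
    module R = RawRing R
  open RawRing S
  field
    fun           : R.Carrier → Carrier
    isEquivalence : IsEquivalence _≈_
    +-cong        : Congruent₂ _≈_ _+_
    *-cong        : Congruent₂ _≈_ _*_
    -‿cong        : Congruent₁ _≈_ -_
    0-homo        : fun R.0# ≈ 0#
    1-homo        : fun R.1# ≈ 1#
    +-homo        : ∀ x y → fun (x R.+ y) ≈ fun x + fun y
    *-homo        : ∀ x y → fun (x R.* y) ≈ fun x * fun y
    -‿homo        : ∀ x → fun (R.- x) ≈ - fun x

  open IsEquivalence isEquivalence

  ⟦⟧-homo : ∀ (f : Poly Var) ρ → fun (⟦ R ⟧ f ρ) ≈ ⟦ S ⟧ f (fun ∘ ρ)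
  ⟦⟧-homo (var v)  ρ = refl
  ⟦⟧-homo :0       ρ = 0-homo
  ⟦⟧-homo :1       ρ = 1-homo
  ⟦⟧-homo (f :+ g) ρ = trans (+-homo _ _) (+-cong (⟦⟧-homo f ρ) (⟦⟧-homo g ρ))
  ⟦⟧-homo (f :* g) ρ = trans (*-homo _ _) (*-cong (⟦⟧-homo f ρ) (⟦⟧-homo g ρ))
  ⟦⟧-homo (:- f)   ρ = trans (-‿homo _) (-‿cong (⟦⟧-homo f ρ))

rename : (Var → Var′) → Poly Var → Poly Var′
rename r (var v)  = var (r v)
rename r :0       = :0
rename r :1       = :1
rename r (f :+ g) = rename r f :+ rename r g
rename r (f :* g) = rename r f :* rename r g
rename r (:- f)   = :- rename r f

⟦rename⟧ : ∀ (R : RawRing c ℓ) (r : Var → Var′) f ρ → ⟦ R ⟧ (rename r f) ρ ≡ ⟦ R ⟧ f (ρ ∘ r)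
⟦rename⟧ R r (var v)  ρ = ≡.refl
⟦rename⟧ R r :0       ρ = ≡.refl
⟦rename⟧ R r :1       ρ = ≡.refl
⟦rename⟧ R r (f :+ g) ρ = ≡.cong₂ (RawRing._+_ R) (⟦rename⟧ R r f ρ) (⟦rename⟧ R r g ρ)
⟦rename⟧ R r (f :* g) ρ = ≡.cong₂ (RawRing._*_ R) (⟦rename⟧ R r f ρ) (⟦rename⟧ R r g ρ)
⟦rename⟧ R r (:- f)   ρ = ≡.cong (RawRing.-_ R) (⟦rename⟧ R r f ρ)

-- Polynomials in n + 1 variables as univariate polynomials over polynomials in n variables.

addᶜ : List (Poly Var) → List (Poly Var) → List (Poly Var)
addᶜ []       gs       = gs
addᶜ (f ∷ fs) []       = f ∷ fs
addᶜ (f ∷ fs) (g ∷ gs) = f :+ g ∷ addᶜ fs gs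

mulᶜ : List (Poly Var) → List (Poly Var) → List (Poly Var)
mulᶜ []       gs = []
mulᶜ (f ∷ fs) gs = addᶜ (map (f :*_) gs) (:0 ∷ mulᶜ fs gs)

coeffs : ∀ {n} → Poly (Fin (suc n)) → List (Poly (Fin n))
coeffs (var zero)    = :0 ∷ :1 ∷ []
coeffs (var (suc i)) = var i ∷ []
coeffs :0            = []
coeffs :1            = :1 ∷ []
coeffs (f :+ g)      = addᶜ (coeffs f) (coeffs g)
coeffs (f :* g)      = mulᶜ (coeffs f) (coeffs g)
coeffs (:- f)        = map :-_ (coeffs f)

-- A closed polynomial is a difference of two natural numbers.
posneg : Poly (Fin 0) → ℕ × ℕ
posneg :0       = 0 , 0
posneg :1       = 1 , 0
posneg (f :+ g) = let a , b = posneg f ; a′ , b′ = posneg g in a ℕ.+ a′ , b ℕ.+ b′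
posneg (f :* g) = let a , b = posneg f ; a′ , b′ = posneg g in
                  a ℕ.* a′ ℕ.+ b ℕ.* b′ , a ℕ.* b′ ℕ.+ b ℕ.* a′
posneg (:- f)   = let a , b = posneg f in b , a

module EvaluationProperties (A : CommutativeRing c ℓ) where
  open CommutativeRing A hiding (zero)
  open import Algebra.Properties.Ring ring
    using (-‿distribʳ-*; -‿+-comm; -0#≈0#)
  open import Algebra.Properties.Semiring.Mult semiring using (×-homo-+; ×1-homo-*)
    renaming (_×_ to _·_)
  open import Algebra.Solver.Ring.NaturalCoefficients.Default commutativeSemiring
    using (solve; _:=_) renaming (_:+_ to _⊞_; _:*_ to _⊠_)
  open import Relation.Binary.Reasoning.Setoid setoid

  private
    ⟦_⟧ᴬ : Poly Var → (Var → Carrier) → Carrier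
    ⟦_⟧ᴬ = ⟦_⟧ rawRing

    hornerᴬ : ∀ {n} → Carrier → List (Poly (Fin n)) → (Fin n → Carrier) → Carrier
    hornerᴬ x fs ρ = horner rawRing x (map (λ f → ⟦ f ⟧ᴬ ρ) fs)

  ⟦⟧-cong : ∀ (f : Poly Var) {ρ ρ′} → (∀ v → ρ v ≈ ρ′ v) → ⟦ f ⟧ᴬ ρ ≈ ⟦ f ⟧ᴬ ρ′
  ⟦⟧-cong (var v)  e = e v
  ⟦⟧-cong :0       e = refl
  ⟦⟧-cong :1       e = refl
  ⟦⟧-cong (f :+ g) e = +-cong (⟦⟧-cong f e) (⟦⟧-cong g e)
  ⟦⟧-cong (f :* g) e = *-cong (⟦⟧-cong f e) (⟦⟧-cong g e)
  ⟦⟧-cong (:- f)   e = -‿cong (⟦⟧-cong f e)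

  horner-add : ∀ {n} x (fs gs : List (Poly (Fin n))) ρ →
               hornerᴬ x (addᶜ fs gs) ρ ≈ hornerᴬ x fs ρ + hornerᴬ x gs ρ
  horner-add x []       gs       ρ = sym (+-identityˡ _)
  horner-add x (f ∷ fs) []       ρ = sym (+-identityʳ _)
  horner-add x (f ∷ fs) (g ∷ gs) ρ = trans (+-congˡ (*-congˡ (horner-add x fs gs ρ)))
    (solve 5 (λ x a b s t → (a ⊞ b) ⊞ x ⊠ (s ⊞ t) := (a ⊞ x ⊠ s) ⊞ (b ⊞ x ⊠ t))
       refl x (⟦ f ⟧ᴬ ρ) (⟦ g ⟧ᴬ ρ) _ _)

  horner-scale : ∀ {n} x f (gs : List (Poly (Fin n))) ρ →
                 hornerᴬ x (map (f :*_) gs) ρ ≈ ⟦ f ⟧ᴬ ρ * hornerᴬ x gs ρ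
  horner-scale x f []       ρ = sym (zeroʳ _)
  horner-scale x f (g ∷ gs) ρ = trans (+-congˡ (*-congˡ (horner-scale x f gs ρ)))
    (solve 4 (λ x a b s → a ⊠ b ⊞ x ⊠ (a ⊠ s) := a ⊠ (b ⊞ x ⊠ s))
       refl x (⟦ f ⟧ᴬ ρ) (⟦ g ⟧ᴬ ρ) _)

  horner-mul : ∀ {n} x (fs gs : List (Poly (Fin n))) ρ →
               hornerᴬ x (mulᶜ fs gs) ρ ≈ hornerᴬ x fs ρ * hornerᴬ x gs ρ
  horner-mul x []       gs ρ = sym (zeroˡ _)
  horner-mul x (f ∷ fs) gs ρ = begin
    hornerᴬ x (addᶜ (map (f :*_) gs) (:0 ∷ mulᶜ fs gs)) ρ
      ≈⟨ horner-add x (map (f :*_) gs) (:0 ∷ mulᶜ fs gs) ρ ⟩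
    hornerᴬ x (map (f :*_) gs) ρ + (0# + x * hornerᴬ x (mulᶜ fs gs) ρ)
      ≈⟨ +-cong (horner-scale x f gs ρ)
                (trans (+-identityˡ _) (*-congˡ (horner-mul x fs gs ρ))) ⟩
    ⟦ f ⟧ᴬ ρ * hornerᴬ x gs ρ + x * (hornerᴬ x fs ρ * hornerᴬ x gs ρ)
      ≈⟨ solve 4 (λ x a s t → a ⊠ t ⊞ x ⊠ (s ⊠ t) := (a ⊞ x ⊠ s) ⊠ t)
           refl x (⟦ f ⟧ᴬ ρ) _ _ ⟩
    (⟦ f ⟧ᴬ ρ + x * hornerᴬ x fs ρ) * hornerᴬ x gs ρ ∎

  horner-neg : ∀ {n} x (fs : List (Poly (Fin n))) ρ →
               hornerᴬ x (map :-_ fs) ρ ≈ - hornerᴬ x fs ρ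
  horner-neg x []       ρ = sym -0#≈0#
  horner-neg x (f ∷ fs) ρ = begin
    - ⟦ f ⟧ᴬ ρ + x * hornerᴬ x (map :-_ fs) ρ ≈⟨ +-congˡ (*-congˡ (horner-neg x fs ρ)) ⟩
    - ⟦ f ⟧ᴬ ρ + x * - hornerᴬ x fs ρ         ≈⟨ +-congˡ (-‿distribʳ-* _ _) ⟨
    - ⟦ f ⟧ᴬ ρ + - (x * hornerᴬ x fs ρ)       ≈⟨ -‿+-comm _ _ ⟩
    - (⟦ f ⟧ᴬ ρ + x * hornerᴬ x fs ρ)         ∎

  ⟦coeffs⟧ : ∀ {n} (f : Poly (Fin (suc n))) (ρ : Fin (suc n) → Carrier) →
             ⟦ f ⟧ᴬ ρ ≈ hornerᴬ (ρ zero) (coeffs f) (ρ ∘ suc)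
  ⟦coeffs⟧ (var zero)    ρ =
    solve 1 (λ x → x := con 0 ⊞ x ⊠ (con 1 ⊞ x ⊠ con 0)) refl (ρ zero)
    where open import Algebra.Solver.Ring.NaturalCoefficients.Default commutativeSemiring using (con)
  ⟦coeffs⟧ (var (suc i)) ρ = sym (trans (+-congˡ (zeroʳ _)) (+-identityʳ _))
  ⟦coeffs⟧ :0            ρ = refl
  ⟦coeffs⟧ :1            ρ = sym (trans (+-congˡ (zeroʳ _)) (+-identityʳ _))
  ⟦coeffs⟧ (f :+ g)      ρ = trans (+-cong (⟦coeffs⟧ f ρ) (⟦coeffs⟧ g ρ))
    (sym (horner-add (ρ zero) (coeffs f) (coeffs g) (ρ ∘ suc)))
  ⟦coeffs⟧ (f :* g)      ρ = trans (*-cong (⟦coeffs⟧ f ρ) (⟦coeffs⟧ g ρ))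
    (sym (horner-mul (ρ zero) (coeffs f) (coeffs g) (ρ ∘ suc)))
  ⟦coeffs⟧ (:- f)        ρ = trans (-‿cong (⟦coeffs⟧ f ρ))
    (sym (horner-neg (ρ zero) (coeffs f) (ρ ∘ suc)))

  horner-zero : ∀ {n} x {fs : List (Poly (Fin n))} ρ → All (λ f → ⟦ f ⟧ᴬ ρ ≈ 0#) fs →
                hornerᴬ x fs ρ ≈ 0#
  horner-zero x ρ []       = refl
  horner-zero x ρ (e ∷ es) =
    trans (+-cong e (trans (*-congˡ (horner-zero x ρ es)) (zeroʳ x))) (+-identityˡ 0#)

  ⟦posneg⟧ : ∀ f ρ → ⟦ f ⟧ᴬ ρ + proj₂ (posneg f) · 1# ≈ proj₁ (posneg f) · 1#
  ⟦posneg⟧ :0       ρ = +-identityˡ 0#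
  ⟦posneg⟧ :1       ρ = refl
  ⟦posneg⟧ (f :+ g) ρ = let a , b = posneg f ; a′ , b′ = posneg g in begin
    (⟦ f ⟧ᴬ ρ + ⟦ g ⟧ᴬ ρ) + (b ℕ.+ b′) · 1#       ≈⟨ +-congˡ (×-homo-+ 1# b b′) ⟩
    (⟦ f ⟧ᴬ ρ + ⟦ g ⟧ᴬ ρ) + (b · 1# + b′ · 1#)
      ≈⟨ solve 4 (λ x y z w → (x ⊞ y) ⊞ (z ⊞ w) := (x ⊞ z) ⊞ (y ⊞ w)) refl (⟦ f ⟧ᴬ ρ) _ _ _ ⟩
    (⟦ f ⟧ᴬ ρ + b · 1#) + (⟦ g ⟧ᴬ ρ + b′ · 1#)   ≈⟨ +-cong (⟦posneg⟧ f ρ) (⟦posneg⟧ g ρ) ⟩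
    a · 1# + a′ · 1#                             ≈⟨ ×-homo-+ 1# a a′ ⟨
    (a ℕ.+ a′) · 1#                              ∎
  ⟦posneg⟧ (f :* g) ρ = let a , b = posneg f ; a′ , b′ = posneg g in begin
    x * y + (a ℕ.* b′ ℕ.+ b ℕ.* a′) · 1#         ≈⟨ +-congˡ (homo₂ a b′ b a′) ⟩
    x * y + (a · 1# * b′ · 1# + b · 1# * a′ · 1#)
      ≈⟨ +-congˡ (+-cong (*-congʳ (⟦posneg⟧ f ρ)) (*-congˡ (⟦posneg⟧ g ρ))) ⟨
    x * y + ((x + b · 1#) * b′ · 1# + b · 1# * (y + b′ · 1#))
      ≈⟨ solve 4 (λ x y b b′ → x ⊠ y ⊞ ((x ⊞ b) ⊠ b′ ⊞ b ⊠ (y ⊞ b′))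
                            := (x ⊞ b) ⊠ (y ⊞ b′) ⊞ b ⊠ b′) refl x y _ _ ⟩
    (x + b · 1#) * (y + b′ · 1#) + b · 1# * b′ · 1#
      ≈⟨ +-congʳ (*-cong (⟦posneg⟧ f ρ) (⟦posneg⟧ g ρ)) ⟩
    a · 1# * a′ · 1# + b · 1# * b′ · 1#          ≈⟨ homo₂ a a′ b b′ ⟨
    (a ℕ.* a′ ℕ.+ b ℕ.* b′) · 1#                 ∎
    where
    x = ⟦ f ⟧ᴬ ρ
    y = ⟦ g ⟧ᴬ ρ
    homo₂ : ∀ k l m n → (k ℕ.* l ℕ.+ m ℕ.* n) · 1# ≈ k · 1# * l · 1# + m · 1# * n · 1#
    homo₂ k l m n = trans (×-homo-+ 1# (k ℕ.* l) (m ℕ.* n)) (+-cong (×1-homo-* k l) (×1-homo-* m n))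
  ⟦posneg⟧ (:- f)   ρ = let a , b = posneg f in begin
    - x + a · 1#                 ≈⟨ +-congˡ (⟦posneg⟧ f ρ) ⟨
    - x + (x + b · 1#)           ≈⟨ +-assoc _ _ _ ⟨
    (- x + x) + b · 1#           ≈⟨ +-congʳ (-‿inverseˡ x) ⟩
    0# + b · 1#                  ≈⟨ +-identityˡ _ ⟩
    b · 1#                       ∎
    where x = ⟦ f ⟧ᴬ ρ

module ℤP = EvaluationProperties ℤ.+-*-commutativeRing
open import Algebra.Properties.Semiring.Mult ℤ.+-*-semiring using () renaming (_×_ to _·ℤ_)
open import Algebra.Properties.AbelianGroup ℤ.+-0-abelianGroup
  using () renaming (inverseˡ-unique to +ℤ-inverseˡ-unique)

·ℤ-1 : ∀ n → n ·ℤ ℤ.1ℤ ≡ ℤ.+ n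
·ℤ-1 zero    = ≡.refl
·ℤ-1 (suc n) = ≡.cong (ℤ._+_ ℤ.1ℤ) (·ℤ-1 n)

-- A constant divisible by every nonzero integer vanishes.
const-zero : ∀ a (h : ℤ → ℤ) → (∀ x → x ≢ ℤ.0ℤ → a ℤ.+ x ℤ.* h x ≡ ℤ.0ℤ) → a ≡ ℤ.0ℤ
const-zero a h e = ℤ.∣i∣≡0⇒i≡0 (lemma ℤ.∣ h x ∣ (≡.trans
    (≡.cong ℤ.∣_∣ (+ℤ-inverseˡ-unique a (x ℤ.* h x) (e x (λ ()))))
    (≡.trans (ℤ.∣-i∣≡∣i∣ (x ℤ.* h x)) (ℤ.abs-* x (h x)))))
  where
  x = ℤ.+ suc ℤ.∣ a ∣
  lemma : ∀ {k} m → k ≡ suc k ℕ.* m → k ≡ 0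
  lemma {k} zero    e = ≡.trans e (ℕ.*-zeroʳ (suc k))
  lemma {k} (suc m) e = contradiction
    (ℕ.≤-trans (ℕ.m≤m*n (suc k) (suc m)) (ℕ.≤-reflexive (≡.sym e))) ℕ.1+n≰n

hornerℤ : ∀ {n} → ℤ → List (Poly (Fin n)) → (Fin n → ℤ) → ℤ
hornerℤ x fs ρ = horner ℤ.+-*-rawRing x (map (λ f → ⟦ f ⟧ℤ ρ) fs)

hornerℤ-vanishing : ∀ {n} (fs : List (Poly (Fin n))) →
  (∀ ρ x → x ≢ ℤ.0ℤ → hornerℤ x fs ρ ≡ ℤ.0ℤ) → All (_≐ :0) fs
hornerℤ-vanishing []       e = []
hornerℤ-vanishing (f ∷ fs) e = f≐0 ∷ hornerℤ-vanishing fs λ ρ x x≢0 →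
  Sum.[ (λ x≡0 → contradiction x≡0 x≢0) , id ]′ (ℤ.i*j≡0⇒i≡0∨j≡0 x (≡.trans
    (≡.sym (≡.trans (≡.cong (λ a → a ℤ.+ x ℤ.* hornerℤ x fs ρ) (at f≐0 ρ)) (ℤ.+-identityˡ _)))
    (e ρ x x≢0)))
  where
  f≐0 : f ≐ :0
  f≐0 = pointwise λ ρ → const-zero (⟦ f ⟧ℤ ρ) (λ x → hornerℤ x fs ρ) (e ρ)

cons : ∀ {a} {A : Set a} {n} → A → (Fin n → A) → Fin (suc n) → A
cons x ρ zero    = x
cons x ρ (suc i) = ρ i

clamp : ∀ {m} N → Fin m × ℕ → Fin (m ℕ.* suc N)
clamp N (u , i) = combine u (fromℕ< (ℕ.s≤s (ℕ.m⊓n≤n i N)))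

unclamp : ∀ {m} N → Fin (m ℕ.* suc N) → Fin m × ℕ
unclamp N j = Product.map₂ toℕ (remQuot (suc N) j)

unclamp-clamp : ∀ {m} N (u : Fin m) {i} → i ℕ.≤ N → unclamp N (clamp N (u , i)) ≡ (u , i)
unclamp-clamp N u {i} i≤N = ≡.trans
  (≡.cong (Product.map₂ toℕ) (remQuot-combine u _))
  (≡.cong (u ,_) (≡.trans (toℕ-fromℕ< _) (ℕ.m≤n⇒m⊓n≡m i≤N)))

bound : Poly (Var′ × ℕ) → ℕ
bound (var (u , i)) = i
bound :0            = 0
bound :1            = 0
bound (f :+ g)      = bound f ℕ.⊔ bound g
bound (f :* g)      = bound f ℕ.⊔ bound g
bound (:- f)        = bound f

module Transfer (A : CommutativeRing c ℓ) where
  open CommutativeRing A hiding (zero)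
  open EvaluationProperties A
  open import Algebra.Properties.Semiring.Mult semiring using () renaming (_×_ to _·_)
  open import Algebra.Properties.Group +-group using (identityˡ-unique; ∙-cancelʳ)

  private
    ⟦_⟧ᴬ : Poly Var → (Var → Carrier) → Carrier
    ⟦_⟧ᴬ = ⟦_⟧ rawRing

    vanish : ∀ n (f : Poly (Fin n)) → f ≐ :0 → ∀ ρ → ⟦ f ⟧ᴬ ρ ≈ 0#
    vanish zero f e ρ = identityˡ-unique (⟦ f ⟧ᴬ ρ) (proj₂ (posneg f) · 1#)
      (trans (⟦posneg⟧ f ρ) (reflexive (≡.cong (_· 1#) (≡.sym b≡a))))
      where
      ρ₀ : Fin 0 → ℤ
      ρ₀ ()
      b≡a : proj₂ (posneg f) ≡ proj₁ (posneg f)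
      b≡a = ℤ.+-injective (≡.trans (≡.sym (·ℤ-1 _)) (≡.trans
        (≡.sym (≡.trans (≡.cong (ℤ._+ (proj₂ (posneg f) ·ℤ ℤ.1ℤ)) (at e ρ₀)) (ℤ.+-identityˡ _)))
        (≡.trans (ℤP.⟦posneg⟧ f ρ₀) (·ℤ-1 _))))
    vanish (suc n) f e ρ = trans (⟦coeffs⟧ f ρ)
      (horner-zero (ρ zero) (ρ ∘ suc) (All.map (λ {g} g≐0 → vanish n g g≐0 (ρ ∘ suc))
        (hornerℤ-vanishing (coeffs f) λ ρ′ x _ →
          ≡.trans (≡.sym (ℤP.⟦coeffs⟧ f (cons x ρ′))) (at e (cons x ρ′)))))

    ⟦⟧-cong-bound : ∀ (f : Poly (Var′ × ℕ)) N {ρ ρ′} → bound f ℕ.≤ N →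
      (∀ u {i} → i ℕ.≤ N → ρ (u , i) ≈ ρ′ (u , i)) → ⟦ f ⟧ᴬ ρ ≈ ⟦ f ⟧ᴬ ρ′
    ⟦⟧-cong-bound (var (u , i)) N b e = e u b
    ⟦⟧-cong-bound :0            N b e = refl
    ⟦⟧-cong-bound :1            N b e = refl
    ⟦⟧-cong-bound (f :+ g)      N b e = +-cong
      (⟦⟧-cong-bound f N (ℕ.m⊔n≤o⇒m≤o _ _ b) e) (⟦⟧-cong-bound g N (ℕ.m⊔n≤o⇒n≤o (bound f) _ b) e)
    ⟦⟧-cong-bound (f :* g)      N b e = *-cong
      (⟦⟧-cong-bound f N (ℕ.m⊔n≤o⇒m≤o _ _ b) e) (⟦⟧-cong-bound g N (ℕ.m⊔n≤o⇒n≤o (bound f) _ b) e)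
    ⟦⟧-cong-bound (:- f)        N b e = -‿cong (⟦⟧-cong-bound f N b e)

    vanish′ : ∀ {m} (f : Poly (Fin m × ℕ)) → f ≐ :0 → ∀ ρ → ⟦ f ⟧ᴬ ρ ≈ 0#
    vanish′ f e ρ = trans
      (⟦⟧-cong-bound f N ℕ.≤-refl λ u i≤N → reflexive (≡.cong ρ (≡.sym (unclamp-clamp N u i≤N))))
      (trans (reflexive (≡.sym (⟦rename⟧ rawRing (clamp N) f (ρ ∘ unclamp N))))
        (vanish _ (rename (clamp N) f)
          (pointwise λ ρ′ →
            ≡.trans (⟦rename⟧ ℤ.+-*-rawRing (clamp N) f ρ′) (at e (ρ′ ∘ clamp N)))
          (ρ ∘ unclamp N)))
      where N = bound f

  transfer : ∀ {m} {f g : Poly (Fin m × ℕ)} → f ≐ g → ∀ ρ → ⟦ f ⟧ᴬ ρ ≈ ⟦ g ⟧ᴬ ρ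
  transfer {f = f} {g} e ρ = ∙-cancelʳ (- ⟦ g ⟧ᴬ ρ) _ _ (trans
    (vanish′ (f :+ :- g)
      (pointwise λ ρ′ →
        ≡.trans (≡.cong (ℤ._+ (ℤ.- ⟦ g ⟧ℤ ρ′)) (at e ρ′)) (ℤ.+-inverseʳ (⟦ g ⟧ℤ ρ′))) ρ)
    (sym (-‿inverseʳ (⟦ g ⟧ᴬ ρ))))

  evaluate : (Var → Carrier) → RawHom (CommutativeRing.rawRing ℤ[ Var ]) rawRing
  evaluate ρ = record
    { fun           = λ f → ⟦ f ⟧ᴬ ρ
    ; isEquivalence = isEquivalence
    ; +-cong        = +-cong
    ; *-cong        = *-cong
    ; -‿cong        = -‿cong
    ; 0-homo        = refl
    ; 1-homo        = refl
    ; +-homo        = λ _ _ → refl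
    ; *-homo        = λ _ _ → refl
    ; -‿homo        = λ _ → refl
    }

prime∣! : ∀ {p} → Prime p → ∀ {k} → k ℕ.< p → ¬ p ∣ k !
prime∣! pr {zero}  k<p p∣1 = contradiction (∣1⇒≡1 p∣1) λ { ≡.refl → ¬prime[1] pr }
prime∣! pr {suc k} k<p p∣k! with euclidsLemma (suc k) (k !) pr p∣k!
... | inj₁ p∣k = contradiction k<p (ℕ.≤⇒≯ (∣⇒≤ p∣k))
... | inj₂ p∣k = prime∣! pr (ℕ.<⇒≤ k<p) p∣k

p∣pCk : ∀ {p} → Prime p → ∀ {k} → 0 ℕ.< k → k ℕ.< p → p ∣ (p C k)
p∣pCk {p} pr {k} 0<k k<p with euclidsLemma (p C k) (k ! ℕ.* (p ℕ.∸ k) !) pr p∣p!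
  where
  instance
    _ = k !* (p ℕ.∸ k) !≢0
  p!≡ : (p C k) ℕ.* (k ! ℕ.* (p ℕ.∸ k) !) ≡ p !
  p!≡ = ≡.trans (≡.cong (ℕ._* (k ! ℕ.* (p ℕ.∸ k) !)) (nCk≡n!/k![n-k]! (ℕ.<⇒≤ k<p)))
    (m/n*n≡m (k![n∸k]!∣n! (ℕ.<⇒≤ k<p)))
  p∣p! : p ∣ (p C k) ℕ.* (k ! ℕ.* (p ℕ.∸ k) !)
  p∣p! = ≡.subst (p ∣_) (≡.sym p!≡) (p∣p!′ pr)
    where
    p∣p!′ : ∀ {p} → Prime p → p ∣ p !
    p∣p!′ {zero}  pr = contradiction pr ¬prime[0]
    p∣p!′ {suc p} pr = m∣m*n (p !)
... | inj₁ d = d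
... | inj₂ d with euclidsLemma (k !) ((p ℕ.∸ k) !) pr d
...   | inj₁ d′ = contradiction d′ (prime∣! pr k<p)
...   | inj₂ d′ = contradiction d′ (prime∣! pr (ℕ.∸-monoʳ-< 0<k (ℕ.<⇒≤ k<p)))

module Congruence (B : CommutativeRing c ℓ) where
  open CommutativeRing B hiding (zero)
  open import Algebra.Properties.Ring ring using (-‿distribʳ-*; -‿+-comm)
  open import Algebra.Properties.CommutativeSemiring.Exp commutativeSemiring
  open import Algebra.Properties.Semiring.Mult semiring
    using (×-assoc-*; ×-assocˡ; ×-congˡ) renaming (_×_ to _·_)
  open import Algebra.Properties.Semiring.Sum semiring
    using (sum; sum-cong-≋; sum-init-last; *-distribˡ-sum)
  open import Algebra.Properties.CommutativeSemiring.Binomial commutativeSemiring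
    using (binomial) renaming (theorem to binomial-theorem)
  open import Algebra.Solver.Ring.NaturalCoefficients.Default commutativeSemiring
    using (solve; _:=_) renaming (_:+_ to _⊞_; _:*_ to _⊠_)
  open import Relation.Binary.Reasoning.Setoid setoid

  infix 4 _≡_[mod_]
  _≡_[mod_] : Carrier → Carrier → Carrier → Set _
  x ≡ y [mod m ] = ∃ λ h → x ≈ y + m * h

  private variable
    m x x′ y y′ z : Carrier

  ≈⇒≡ : x ≈ y → x ≡ y [mod m ]
  ≈⇒≡ e = 0# , trans e (sym (trans (+-congˡ (zeroʳ _)) (+-identityʳ _)))

  ≡-sym : x ≡ y [mod m ] → y ≡ x [mod m ]
  ≡-sym {x} {y} {m} (h , e) = - h , sym (begin
    x + m * - h            ≈⟨ +-cong e (sym (-‿distribʳ-* m h)) ⟩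
    y + m * h + - (m * h)  ≈⟨ +-assoc _ _ _ ⟩
    y + (m * h - m * h)    ≈⟨ +-congˡ (-‿inverseʳ _) ⟩
    y + 0#                 ≈⟨ +-identityʳ y ⟩
    y                      ∎)

  ≡-trans : x ≡ y [mod m ] → y ≡ z [mod m ] → x ≡ z [mod m ]
  ≡-trans {m = m} {z} (h , e) (k , e′) = k + h , trans e (trans (+-congʳ e′)
    (solve 4 (λ z m h k → (z ⊞ m ⊠ k) ⊞ m ⊠ h := z ⊞ m ⊠ (k ⊞ h)) refl z m h k))

  ≡-+ : x ≡ y [mod m ] → x′ ≡ y′ [mod m ] → x + x′ ≡ y + y′ [mod m ]
  ≡-+ {y = y} {m} {y′ = y′} (h , e) (k , e′) = h + k , trans (+-cong e e′)
    (solve 5 (λ y y′ m h k → (y ⊞ m ⊠ h) ⊞ (y′ ⊞ m ⊠ k) := (y ⊞ y′) ⊞ m ⊠ (h ⊞ k))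
       refl y y′ m h k)

  ≡-* : x ≡ y [mod m ] → x′ ≡ y′ [mod m ] → x * x′ ≡ y * y′ [mod m ]
  ≡-* {y = y} {m} {y′ = y′} (h , e) (k , e′) = y * k + h * y′ + m * (h * k) ,
    trans (*-cong e e′)
      (solve 5 (λ y y′ m h k → (y ⊞ m ⊠ h) ⊠ (y′ ⊞ m ⊠ k)
                            := y ⊠ y′ ⊞ m ⊠ (y ⊠ k ⊞ h ⊠ y′ ⊞ m ⊠ (h ⊠ k)))
         refl y y′ m h k)

  ≡-neg : x ≡ y [mod m ] → - x ≡ - y [mod m ]
  ≡-neg (h , e) = - h , trans (-‿cong e) (trans (sym (-‿+-comm _ _)) (+-congˡ (-‿distribʳ-* _ _)))

  ≡-^ : ∀ n → x ≡ y [mod m ] → x ^ n ≡ y ^ n [mod m ]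
  ≡-^ zero    e = ≈⇒≡ refl
  ≡-^ (suc n) e = ≡-* e (≡-^ n e)

  ≡-scale : ∀ k → x ≡ y [mod m ] → k * x ≡ k * y [mod k * m ]
  ≡-scale {y = y} {m} k (h , e) = h , trans (*-congˡ e)
    (solve 4 (λ k y m h → k ⊠ (y ⊞ m ⊠ h) := k ⊠ y ⊞ (k ⊠ m) ⊠ h) refl k y m h)

  -- (y + d)ⁿ⁺¹ = yⁿ⁺¹ + (n + 1) yⁿ d + d² e for some e.
  ^-expand : ∀ n y d → ∃ λ e → (y + d) ^ suc n ≈ y ^ suc n + suc n · 1# * (y ^ n * d) + d * d * e
  ^-expand zero    y d = 0# , trans (*-identityʳ (y + d)) (sym (begin
    y * 1# + (1# + 0#) * (1# * d) + d * d * 0#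
      ≈⟨ +-cong (+-cong (*-identityʳ y) (trans (*-congʳ (+-identityʳ 1#))
           (trans (*-identityˡ _) (*-identityˡ d)))) (zeroʳ _) ⟩
    y + d + 0# ≈⟨ +-identityʳ _ ⟩
    y + d      ∎))
  ^-expand (suc n) y d = let e , eq = ^-expand n y d in
    suc n · 1# * y ^ n + (y + d) * e , (begin
    (y + d) * (y + d) ^ suc n ≈⟨ *-congˡ eq ⟩
    (y + d) * (y * y ^ n + suc n · 1# * (y ^ n * d) + d * d * e)
      ≈⟨ solve 5 (λ y d t N e → (y ⊞ d) ⊠ (y ⊠ t ⊞ N ⊠ (t ⊠ d) ⊞ d ⊠ d ⊠ e)
           := y ⊠ (y ⊠ t) ⊞ ((y ⊠ t) ⊠ d ⊞ N ⊠ ((y ⊠ t) ⊠ d)) ⊞ d ⊠ d ⊠ (N ⊠ t ⊞ (y ⊞ d) ⊠ e))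
         refl y d (y ^ n) (suc n · 1#) e ⟩
    y * (y * y ^ n) + (y * y ^ n * d + suc n · 1# * (y * y ^ n * d))
      + d * d * (suc n · 1# * y ^ n + (y + d) * e)
      ≈⟨ +-congʳ (+-congˡ (trans (+-congʳ (sym (*-identityˡ _))) (sym (distribʳ _ _ _)))) ⟩
    y * (y * y ^ n) + (1# + suc n · 1#) * (y * y ^ n * d)
      + d * d * (suc n · 1# * y ^ n + (y + d) * e) ∎)

  module _ {p : ℕ} (prime : Prime p) where
    private
      p̂ = p · 1#

      p·-* : ∀ k x → (p ℕ.* k) · x ≈ p̂ * (k · x)
      p·-* k x = trans (sym (×-assocˡ x p k))
        (sym (trans (×-assoc-* p 1# (k · x)) (Mult.×-congʳ p (*-identityˡ _))))
        where import Algebra.Properties.Semiring.Mult semiring as Mult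

    -- If m is a multiple of p, then p-th powers improve congruences modulo m to modulo p m.
    ≡-^p : ∀ k → m ≈ p̂ * k → x ≡ y [mod m ] → x ^ p ≡ y ^ p [mod p̂ * m ]
    ≡-^p {m} {x} {y} k m≈ (h , e) = go p ≡.refl
      where
      go : ∀ q → p ≡ q → x ^ q ≡ y ^ q [mod p̂ * m ]
      go zero    p≡0 = ≈⇒≡ refl
      go (suc n) ≡.refl = let r , eq = ^-expand n y (m * h) in y ^ n * h + k * (h * h) * r , (begin
        x ^ suc n            ≈⟨ ^-congˡ (suc n) e ⟩
        (y + m * h) ^ suc n  ≈⟨ eq ⟩
        y ^ suc n + p̂ * (y ^ n * (m * h)) + m * h * (m * h) * r
          ≈⟨ +-congˡ (*-congʳ (*-congʳ (*-congʳ m≈))) ⟩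
        y ^ suc n + p̂ * (y ^ n * (m * h)) + p̂ * k * h * (m * h) * r
          ≈⟨ solve 7 (λ t s P m k h r → t ⊞ P ⊠ (s ⊠ (m ⊠ h)) ⊞ P ⊠ k ⊠ h ⊠ (m ⊠ h) ⊠ r
               := t ⊞ P ⊠ m ⊠ (s ⊠ h ⊞ k ⊠ (h ⊠ h) ⊠ r))
             refl (y ^ suc n) (y ^ n) p̂ m k h r ⟩
        y ^ suc n + p̂ * m * (y ^ n * h + k * (h * h) * r) ∎)

    freshman : ∀ x y → (x + y) ^ p ≡ x ^ p + y ^ p [mod p̂ ]
    freshman x y = go p ≡.refl
      where
      go : ∀ q → p ≡ q → (x + y) ^ q ≡ x ^ q + y ^ q [mod p̂ ]
      go zero          p≡0    = contradiction (≡.subst Prime p≡0 prime) ¬prime[0]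
      go (suc n) ≡.refl = sum middle , (begin
        (x + y) ^ suc n
          ≈⟨ binomial-theorem (suc n) x y ⟩
        term zero + sum (term ∘ suc)
          ≈⟨ +-cong first (trans (sum-init-last (term ∘ suc))
               (+-cong (trans (sum-cong-≋ inner) (sym (*-distribˡ-sum p̂ middle))) final)) ⟩
        y ^ suc n + (p̂ * sum middle + x ^ suc n)
          ≈⟨ solve 3 (λ a b c → b ⊞ (c ⊞ a) := a ⊞ b ⊞ c) refl _ _ _ ⟩
        x ^ suc n + y ^ suc n + p̂ * sum middle ∎)
        where
        term : Fin (suc (suc n)) → Carrier
        term k = (suc n C toℕ k) · binomial x y (suc n) k

        divisible : ∀ (i : Fin n) → suc n ∣ (suc n C suc (toℕ (inject₁ i)))
        divisible i = p∣pCk prime ℕ.z<s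
          (ℕ.s<s (≡.subst (ℕ._< n) (≡.sym (toℕ-inject₁ i)) (toℕ<n i)))

        middle : Fin n → Carrier
        middle i = quotient (divisible i) · binomial x y (suc n) (suc (inject₁ i))

        inner : ∀ i → term (suc (inject₁ i)) ≈ p̂ * middle i
        inner i = trans (×-congˡ (≡.trans (_∣_.equality (divisible i)) (ℕ.*-comm (quotient (divisible i)) (suc n))))
          (p·-* (quotient (divisible i)) _)

        first : term zero ≈ y ^ suc n
        first = trans (×-congˡ {1# * y ^ suc n} {suc n C 0} {1} ≡.refl) (trans (+-identityʳ _) (*-identityˡ _))

        final : term (suc (fromℕ n)) ≈ x ^ suc n
        final rewrite toℕ-fromℕ n = trans (×-congˡ (nCn≡1 (suc n))) (trans (+-identityʳ _)
          (trans (*-congˡ (^-congʳ y (ℕ.n∸n≡0 n))) (*-identityʳ _)))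

module Witt {p : ℕ} (prime : Prime p) where

  module Ghost (A : CommutativeRing c ℓ) where
    open CommutativeRing A hiding (zero)
    open import Algebra.Properties.CommutativeSemiring.Exp commutativeSemiring
    open import Algebra.Properties.Semiring.Mult semiring using () renaming (_×_ to _·_)
    open import Algebra.Properties.Semiring.Sum semiring
      using (sum; sum-cong-≋; sum⁺-syntax; *-distribˡ-sum)
    open Congruence A

    p̂ : Carrier
    p̂ = p · 1#

    ghostTerm : ℕ → (ℕ → Carrier) → ℕ → Carrier
    ghostTerm n a i = p̂ ^ i * a i ^ (p ℕ.^ (n ℕ.∸ i))

    ghost : ℕ → (ℕ → Carrier) → Carrier
    ghost n a = ∑[ i ≤ n ] ghostTerm n a (toℕ i)

    ghost-zero : ∀ a → ghost 0 a ≈ a 0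
    ghost-zero a = trans (+-identityʳ _) (trans (*-identityˡ _) (*-identityʳ _))

    ghost-suc : ∀ n a → ghost (suc n) a ≈ a 0 ^ (p ℕ.^ suc n) + p̂ * ghost n (a ∘ suc)
    ghost-suc n a = +-cong (*-identityˡ _) (trans
      (sum-cong-≋ {suc n} {ghostTerm (suc n) a ∘ suc ∘ toℕ} (λ i → *-assoc p̂ (p̂ ^ toℕ i) _))
      (sym (*-distribˡ-sum {suc n} p̂ (ghostTerm n (a ∘ suc) ∘ toℕ))))

    ghost-cong : ∀ n {a b} → (∀ i → a i ≈ b i) → ghost n a ≈ ghost n b
    ghost-cong n {a} {b} e = sum-cong-≋ {suc n} {ghostTerm n a ∘ toℕ} {ghostTerm n b ∘ toℕ}
      λ i → *-congˡ {p̂ ^ toℕ i} (^-congˡ (p ℕ.^ (n ℕ.∸ toℕ i)) (e (toℕ i)))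

    x^p^[1+n] : ∀ x n → x ^ (p ℕ.^ suc n) ≈ (x ^ p) ^ (p ℕ.^ n)
    x^p^[1+n] x n = sym (^-assocʳ x p (p ℕ.^ n))

    x^p^[1+n]′ : ∀ x n → x ^ (p ℕ.^ suc n) ≈ (x ^ (p ℕ.^ n)) ^ p
    x^p^[1+n]′ x n = trans (^-congʳ x (ℕ.*-comm p (p ℕ.^ n))) (sym (^-assocʳ x (p ℕ.^ n) p))

    ≡-^p^ : ∀ {x y} n → x ≡ y [mod p̂ ] → x ^ (p ℕ.^ n) ≡ y ^ (p ℕ.^ n) [mod p̂ ^ suc n ]
    ≡-^p^ {x} {y} zero    (h , e) = h , trans (*-identityʳ x)
      (trans e (+-cong (sym (*-identityʳ y)) (*-congʳ (sym (*-identityʳ p̂)))))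
    ≡-^p^ {x} {y} (suc n) e = ≡-trans (≈⇒≡ (x^p^[1+n]′ x n)) (≡-trans
      (≡-^p prime (p̂ ^ n) refl (≡-^p^ n e)) (≈⇒≡ (sym (x^p^[1+n]′ y n))))

    ≡-weaken : ∀ {x y} n → x ≡ y [mod p̂ ^ suc n ] → x ≡ y [mod p̂ ]
    ≡-weaken n (h , e) = p̂ ^ n * h , trans e (+-congˡ (*-assoc _ _ _))

    ghost-frobenius : ∀ n a → ghost (suc n) a ≡ ghost n (λ i → a i ^ p) [mod p̂ ^ suc n ]
    ghost-frobenius zero    a = a 1 , trans (ghost-suc 0 a) (+-cong
      (trans (x^p^[1+n] (a 0) 0) (sym (trans (ghost-zero (λ i → a i ^ p)) (sym (*-identityʳ _)))))
      (*-cong (sym (*-identityʳ p̂)) (ghost-zero (a ∘ suc))))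
    ghost-frobenius (suc n) a = ≡-trans (≈⇒≡ (ghost-suc (suc n) a)) (≡-trans
      (≡-+ (≈⇒≡ (x^p^[1+n] (a 0) (suc n))) (≡-scale p̂ (ghost-frobenius n (a ∘ suc))))
      (≈⇒≡ (sym (ghost-suc n (λ i → a i ^ p)))))

  module _ (A : CommutativeRing c ℓ) (B : CommutativeRing c′ ℓ′)
           (h : RawHom (CommutativeRing.rawRing A) (CommutativeRing.rawRing B)) where
    private
      module A = CommutativeRing A
      module AE where
        open import Algebra.Properties.Semiring.Exp A.semiring public
        open import Algebra.Properties.Semiring.Mult A.semiring public
        open import Algebra.Properties.Semiring.Sum A.semiring public
      module BE where
        open import Algebra.Properties.Semiring.Exp (CommutativeRing.semiring B) public
        open import Algebra.Properties.Semiring.Mult (CommutativeRing.semiring B) public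
        open import Algebra.Properties.Semiring.Sum (CommutativeRing.semiring B) public
    open CommutativeRing B hiding (zero)
    open RawHom h using (fun; 0-homo; 1-homo; +-homo; *-homo)

    ^-homo : ∀ x n → fun (x AE.^ n) ≈ fun x BE.^ n
    ^-homo x zero    = 1-homo
    ^-homo x (suc n) = trans (*-homo _ _) (*-congˡ (^-homo x n))

    ·1-homo : ∀ n → fun (n AE.× A.1#) ≈ n BE.× 1#
    ·1-homo zero    = 0-homo
    ·1-homo (suc n) = trans (+-homo _ _) (+-cong 1-homo (·1-homo n))

    sum-homo : ∀ {n} (t : Fin n → A.Carrier) → fun (AE.sum t) ≈ BE.sum (fun ∘ t)
    sum-homo {zero}  t = 0-homo
    sum-homo {suc n} t = trans (+-homo _ _) (+-congˡ (sum-homo (t ∘ suc)))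

    ghost-homo : ∀ n a → fun (Ghost.ghost A n a) ≈ Ghost.ghost B n (fun ∘ a)
    ghost-homo n a = trans (sum-homo {suc n} (Ghost.ghostTerm A n a ∘ toℕ))
      (BE.sum-cong-≋ {suc n} {fun ∘ Ghost.ghostTerm A n a ∘ toℕ}
                             {Ghost.ghostTerm B n (fun ∘ a) ∘ toℕ} λ i →
      trans (*-homo _ _) (*-cong
        (trans (^-homo _ (toℕ i)) (BE.^-congˡ (toℕ i) (·1-homo p)))
        (^-homo (a (toℕ i)) (p ℕ.^ (n ℕ.∸ toℕ i)))))

  module _ {Var : Set} where
    private
      module P = CommutativeRing ℤ[ Var ]
      module Pᴳ = Ghost ℤ[ Var ]
    open import Algebra.Properties.CommutativeSemiring.Exp P.commutativeSemiring
      using (_^_; ^-congˡ; ^-congʳ; ^-distrib-*)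
    open Pᴳ using (p̂)
    open Congruence ℤ[ Var ]

    φ-hom : RawHom P.rawRing P.rawRing
    φ-hom = Transfer.evaluate ℤ[ Var ] (λ v → var v ^ p)

    φ : Poly Var → Poly Var
    φ = RawHom.fun φ-hom

    atℤ : (Var → ℤ) → RawHom P.rawRing ℤ.+-*-rawRing
    atℤ = Transfer.evaluate ℤ.+-*-commutativeRing

    ⟦φ⟧ : ∀ f ρ → ⟦ φ f ⟧ℤ ρ ≡ ⟦ f ⟧ℤ (λ v → ⟦ var v ^ p ⟧ℤ ρ)
    ⟦φ⟧ f ρ = RawHom.⟦⟧-homo (atℤ ρ) f (λ v → var v ^ p)

    φ-cong : ∀ {f g} → f ≐ g → φ f ≐ φ g
    φ-cong {f} {g} e = pointwise λ ρ → ≡.trans (⟦φ⟧ f ρ) (≡.trans (at e _) (≡.sym (⟦φ⟧ g ρ)))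

    ⟦p̂⟧ : ∀ ρ → ⟦ p̂ ⟧ℤ ρ ≡ ℤ.+ p
    ⟦p̂⟧ ρ = ≡.trans (·1-homo ℤ[ Var ] ℤ.+-*-commutativeRing (atℤ ρ) p) (·ℤ-1 p)

    p̂-cancel : ∀ {f g} → p̂ :* f ≐ p̂ :* g → f ≐ g
    p̂-cancel {f} {g} e = pointwise λ ρ → ℤ.*-cancelˡ-≡ (ℤ.+ p) (⟦ f ⟧ℤ ρ) (⟦ g ⟧ℤ ρ)
      {{prime⇒nonZero prime}} (≡.subst (λ m → m ℤ.* ⟦ f ⟧ℤ ρ ≡ m ℤ.* ⟦ g ⟧ℤ ρ) (⟦p̂⟧ ρ) (at e ρ))

    0^p : :0 ^ p ≐ :0
    0^p = go p (prime⇒nonZero prime)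
      where
      go : ∀ n → .(ℕ.NonZero n) → :0 ^ n ≐ :0
      go (suc n) _ = P.zeroˡ (:0 ^ n)

    1^ : ∀ n → :1 ^ n ≐ :1
    1^ zero    = P.refl
    1^ (suc n) = P.trans (P.*-identityˡ _) (1^ n)

    φ-^p : ∀ f → φ f ≡ f ^ p [mod p̂ ]
    φ-^p (var v)  = ≈⇒≡ {x = var v ^ p} P.refl
    φ-^p :0       = ≈⇒≡ {x = :0} (P.sym 0^p)
    φ-^p :1       = ≈⇒≡ {x = :1} (P.sym (1^ p))
    φ-^p (f :+ g) = ≡-trans {x = φ (f :+ g)} (≡-+ (φ-^p f) (φ-^p g)) (≡-sym (freshman prime f g))
    φ-^p (f :* g) = ≡-trans {x = φ (f :* g)} (≡-* (φ-^p f) (φ-^p g))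
      (≈⇒≡ (P.sym (^-distrib-* f g p)))
    φ-^p (:- f)   = ≡-trans {x = φ (:- f)} (≡-neg (φ-^p f)) neg-^p
      where
      -- 0 = (f - f)ᵖ ≡ fᵖ + (-f)ᵖ.
      neg-^p : :- (f ^ p) ≡ (:- f) ^ p [mod p̂ ]
      neg-^p = ≡-trans
        (≡-trans (≈⇒≡ (P.sym (P.trans (P.+-congˡ (P.trans (^-congˡ p (P.-‿inverseʳ f)) 0^p)) (P.+-identityʳ _))))
          (≡-+ (≈⇒≡ {x = :- (f ^ p)} P.refl) (freshman prime f (:- f))))
        (≈⇒≡ (P.trans (P.sym (P.+-assoc _ _ _))
          (P.trans (P.+-congʳ (P.-‿inverseˡ (f ^ p))) (P.+-identityˡ _))))

    Dwork : (ℕ → Poly Var) → Set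
    Dwork f = ∀ n → f (suc n) ≡ φ (f n) [mod p̂ ^ suc n ]

    φ-^ : ∀ f n → φ (f ^ n) ≐ φ f ^ n
    φ-^ f n = ^-homo ℤ[ Var ] ℤ[ Var ] φ-hom f n

    φ-p̂ : φ p̂ ≐ p̂
    φ-p̂ = ·1-homo ℤ[ Var ] ℤ[ Var ] φ-hom p

    module _ (f : ℕ → Poly Var) (d : Dwork f) where
      head-power : ∀ n → f (suc n) ≡ f 0 ^ (p ℕ.^ suc n) [mod p̂ ]
      head-power n = ≡-trans (Pᴳ.≡-weaken n (d n)) (≡-trans (φ-^p (f n)) (rest n))
        where
        rest : ∀ n → f n ^ p ≡ f 0 ^ (p ℕ.^ suc n) [mod p̂ ]
        rest zero    = ≈⇒≡ (^-congʳ (f 0) (≡.sym (ℕ.*-identityʳ p)))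
        rest (suc n) = ≡-trans (≡-^ p (head-power n)) (≈⇒≡ (P.sym (Pᴳ.x^p^[1+n]′ (f 0) (suc n))))

      -- f (n + 1) = f 0 ^ pⁿ⁺¹ + p · tail n.
      tail : ℕ → Poly Var
      tail n = proj₁ (head-power n)

      tail-eq : ∀ n → f (suc n) ≐ f 0 ^ (p ℕ.^ suc n) :+ p̂ :* tail n
      tail-eq n = proj₂ (head-power n)

      tail-Dwork : Dwork tail
      tail-Dwork n = h₂ :+ h₁ , p̂-cancel (∙-cancelˡ a _ _ (begin
        a :+ p̂ :* tail (suc n)
          ≈⟨ tail-eq (suc n) ⟨
        f (suc (suc n))
          ≈⟨ proj₂ (d (suc n)) ⟩
        φ (f (suc n)) :+ p̂ ^ suc (suc n) :* h₁
          ≈⟨ P.+-congʳ (φ-cong (tail-eq n)) ⟩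
        φ (f 0 ^ (p ℕ.^ suc n)) :+ φ p̂ :* φ (tail n) :+ p̂ ^ suc (suc n) :* h₁
          ≈⟨ P.+-congʳ (P.+-cong (P.trans (φ-^ (f 0) (p ℕ.^ suc n))
               (P.trans (proj₂ power) (P.+-congʳ (P.sym (Pᴳ.x^p^[1+n] (f 0) (suc n))))))
               (P.*-congʳ φ-p̂)) ⟩
        a :+ p̂ ^ suc (suc n) :* h₂ :+ p̂ :* φ (tail n) :+ p̂ ^ suc (suc n) :* h₁
          ≈⟨ solve 6 (λ a q m h₂ t h₁ → a ⊞ (q ⊠ m) ⊠ h₂ ⊞ q ⊠ t ⊞ (q ⊠ m) ⊠ h₁
                                      := a ⊞ q ⊠ (t ⊞ m ⊠ (h₂ ⊞ h₁)))
               P.refl a p̂ (p̂ ^ suc n) h₂ (φ (tail n)) h₁ ⟩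
        a :+ p̂ :* (φ (tail n) :+ p̂ ^ suc n :* (h₂ :+ h₁)) ∎))
        where
        open import Algebra.Properties.Group P.+-group using (∙-cancelˡ)
        open import Algebra.Solver.Ring.NaturalCoefficients.Default P.commutativeSemiring
          using (solve; _:=_) renaming (_:+_ to _⊞_; _:*_ to _⊠_)
        open import Relation.Binary.Reasoning.Setoid P.setoid
        a h₁ h₂ : Poly Var
        a  = f 0 ^ (p ℕ.^ suc (suc n))
        h₁ = proj₁ (d (suc n))
        power : φ (f 0) ^ (p ℕ.^ suc n) ≡ (f 0 ^ p) ^ (p ℕ.^ suc n) [mod p̂ ^ suc (suc n) ]
        power = Pᴳ.≡-^p^ (suc n) (φ-^p (f 0))
        h₂ = proj₁ power

    -- Dwork's lemma: a sequence f with f (n + 1) ≡ φ (f n) mod pⁿ⁺¹, where φ sends every variable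
    -- to its p-th power, is the sequence of ghost components of some polynomials.
    coordinates : (f : ℕ → Poly Var) → Dwork f → ℕ → Poly Var
    coordinates f d zero    = f 0
    coordinates f d (suc n) = coordinates (tail f d) (tail-Dwork f d) n

    ghost-coordinates : ∀ f d n → Pᴳ.ghost n (coordinates f d) ≐ f n
    ghost-coordinates f d zero    = Pᴳ.ghost-zero (coordinates f d)
    ghost-coordinates f d (suc n) = P.trans (Pᴳ.ghost-suc n (coordinates f d)) (P.trans
      (P.+-congˡ (P.*-congˡ (ghost-coordinates (tail f d) (tail-Dwork f d) n)))
      (P.sym (tail-eq f d n)))

    fromGhost : ∀ f → Dwork f → ∃ λ s → ∀ n → Pᴳ.ghost n s ≐ f n
    fromGhost f d = coordinates f d , ghost-coordinates f d

    Dwork-+ : ∀ f g → Dwork f → Dwork g → Dwork (λ n → f n :+ g n)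
    Dwork-+ f g d e n = ≡-+ (d n) (e n)

    Dwork-* : ∀ f g → Dwork f → Dwork g → Dwork (λ n → f n :* g n)
    Dwork-* f g d e n = ≡-* (d n) (e n)

    Dwork-neg : ∀ f → Dwork f → Dwork (λ n → :- f n)
    Dwork-neg f d n = ≡-neg (d n)

    Dwork-var : ∀ (X : ℕ → Var) → Dwork (λ n → Pᴳ.ghost n (var ∘ X))
    Dwork-var X n = ≡-trans (Pᴳ.ghost-frobenius n (var ∘ X))
      (≈⇒≡ (P.sym (ghost-homo ℤ[ Var ] ℤ[ Var ] φ-hom n (var ∘ X))))

  module ℤᴳ = Ghost ℤ.+-*-commutativeRing

  ghostᴾ : ∀ {m} → Fin m → ℕ → Poly (Fin m × ℕ)
  ghostᴾ u n = Ghost.ghost ℤ[ _ ] n (λ i → var (u , i))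

  dworkᴾ : ∀ {m} (u : Fin m) → Dwork (ghostᴾ u)
  dworkᴾ u = Dwork-var (u ,_)

  -- The Witt polynomials, whose integrality is Dwork's lemma.
  -- With Xᵢ = var (0F , i), Yᵢ = var (1F , i) and wₙ the n-th ghost component, these satisfy
  -- wₙ(wittAdd) = wₙ(X) + wₙ(Y), wₙ(wittMul) = wₙ(X) wₙ(Y) and wₙ(wittNeg) = - wₙ(X).
  private
    opaque
      addΣ : ∃ λ s → ∀ n → Ghost.ghost ℤ[ Fin 2 × ℕ ] n s ≐ ghostᴾ 0F n :+ ghostᴾ 1F n
      addΣ = fromGhost (λ n → ghostᴾ 0F n :+ ghostᴾ 1F n)
        (Dwork-+ (ghostᴾ 0F) (ghostᴾ 1F) (dworkᴾ 0F) (dworkᴾ 1F))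

      mulΣ : ∃ λ s → ∀ n → Ghost.ghost ℤ[ Fin 2 × ℕ ] n s ≐ ghostᴾ 0F n :* ghostᴾ 1F n
      mulΣ = fromGhost (λ n → ghostᴾ 0F n :* ghostᴾ 1F n)
        (Dwork-* (ghostᴾ 0F) (ghostᴾ 1F) (dworkᴾ 0F) (dworkᴾ 1F))

      negΣ : ∃ λ s → ∀ n → Ghost.ghost ℤ[ Fin 1 × ℕ ] n s ≐ :- ghostᴾ 0F n
      negΣ = fromGhost (λ n → :- ghostᴾ 0F n) (Dwork-neg (ghostᴾ 0F) (dworkᴾ 0F))

  wittAdd wittMul : ℕ → Poly (Fin 2 × ℕ)
  wittAdd = proj₁ addΣ
  wittMul = proj₁ mulΣ

  wittNeg : ℕ → Poly (Fin 1 × ℕ)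
  wittNeg = proj₁ negΣ

  ghost-wittAdd : ∀ n → Ghost.ghost ℤ[ Fin 2 × ℕ ] n wittAdd ≐ ghostᴾ 0F n :+ ghostᴾ 1F n
  ghost-wittAdd = proj₂ addΣ

  ghost-wittMul : ∀ n → Ghost.ghost ℤ[ Fin 2 × ℕ ] n wittMul ≐ ghostᴾ 0F n :* ghostᴾ 1F n
  ghost-wittMul = proj₂ mulΣ

  ghost-wittNeg : ∀ n → Ghost.ghost ℤ[ Fin 1 × ℕ ] n wittNeg ≐ :- ghostᴾ 0F n
  ghost-wittNeg = proj₂ negΣ

  single : ∀ {a} {A : Set a} → (ℕ → A) → Fin 1 × ℕ → A
  single x (0F , i) = x i

  pair : ∀ {a} {A : Set a} → (ℕ → A) → (ℕ → A) → Fin 2 × ℕ → A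
  pair x y (0F , i) = x i
  pair x y (1F , i) = y i

  -- The p-typical Witt vectors: sequences, with operations given by the Witt polynomials.  That
  -- this is a ring when R is (see 𝕎) is inherited from ℤ, where ghost components are jointly
  -- injective, because polynomial identities over ℤ transfer to every commutative ring.
  wittRawRing : RawRing c ℓ → RawRing c ℓ
  wittRawRing R = record
    { Carrier = ℕ → Carrier
    ; _≈_     = λ x y → ∀ n → x n ≈ y n
    ; _+_     = λ x y n → ⟦ R ⟧ (wittAdd n) (pair x y)
    ; _*_     = λ x y n → ⟦ R ⟧ (wittMul n) (pair x y)
    ; -_      = λ x n → ⟦ R ⟧ (wittNeg n) (single x)
    ; 0#      = λ _ → 0#
    ; 1#      = λ { zero → 1# ; (suc _) → 0# }
    }
    where open RawRing R

  Wℤ : RawRing 0ℓ 0ℓ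
  Wℤ = wittRawRing ℤ.+-*-rawRing

  ghost-inj : ∀ n {x y : ℕ → ℤ} → (∀ n → ℤᴳ.ghost n x ≡ ℤᴳ.ghost n y) → x n ≡ y n
  ghost-inj n {x} {y} e = go n
    where
    x₀≡y₀ : x 0 ≡ y 0
    x₀≡y₀ = ≡.trans (≡.sym (ℤᴳ.ghost-zero x)) (≡.trans (e 0) (ℤᴳ.ghost-zero y))
    open import Algebra.Properties.Semiring.Exp ℤ.+-*-semiring using (_^_)
    open import Algebra.Properties.AbelianGroup ℤ.+-0-abelianGroup using (∙-cancelˡ)
    shift : ∀ n → ℤᴳ.ghost n (x ∘ suc) ≡ ℤᴳ.ghost n (y ∘ suc)
    shift n = ℤ.*-cancelˡ-≡ (ℤ.+ p) _ _ {{prime⇒nonZero prime}}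
      (≡.subst (λ m → m ℤ.* ℤᴳ.ghost n (x ∘ suc) ≡ m ℤ.* ℤᴳ.ghost n (y ∘ suc)) (·ℤ-1 p)
        (∙-cancelˡ (y 0 ^ (p ℕ.^ suc n)) _ _ (≡.trans
          (≡.cong (λ a → a ^ (p ℕ.^ suc n) ℤ.+ ℤᴳ.p̂ ℤ.* ℤᴳ.ghost n (x ∘ suc)) (≡.sym x₀≡y₀))
          (≡.trans (≡.sym (ℤᴳ.ghost-suc n x)) (≡.trans (e (suc n)) (ℤᴳ.ghost-suc n y))))))
    go : ∀ n → x n ≡ y n
    go zero    = x₀≡y₀
    go (suc n) = ghost-inj n {x ∘ suc} {y ∘ suc} shift

  module _ (n : ℕ) where
    at-ghost : ∀ {Var} (f : ℕ → Poly Var) ρ →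
      ⟦ Ghost.ghost ℤ[ Var ] n f ⟧ℤ ρ ≡ ℤᴳ.ghost n (λ i → ⟦ f i ⟧ℤ ρ)
    at-ghost f ρ = ghost-homo ℤ[ _ ] ℤ.+-*-commutativeRing
      (Transfer.evaluate ℤ.+-*-commutativeRing ρ) n f

    ghost-hom : RawHom Wℤ ℤ.+-*-rawRing
    ghost-hom = record
      { fun           = ℤᴳ.ghost n
      ; isEquivalence = ≡.isEquivalence
      ; +-cong        = ≡.cong₂ ℤ._+_
      ; *-cong        = ≡.cong₂ ℤ._*_
      ; -‿cong        = ≡.cong (ℤ.-_)
      ; 0-homo        = ghost-0 n
      ; 1-homo        = ghost-1 n
      ; +-homo        = λ x y → let ρ = pair x y in
          ≡.trans (≡.sym (at-ghost wittAdd ρ)) (≡.trans (at (ghost-wittAdd n) ρ)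
            (≡.cong₂ ℤ._+_ (at-ghost (λ i → var (0F , i)) ρ) (at-ghost (λ i → var (1F , i)) ρ)))
      ; *-homo        = λ x y → let ρ = pair x y in
          ≡.trans (≡.sym (at-ghost wittMul ρ)) (≡.trans (at (ghost-wittMul n) ρ)
            (≡.cong₂ ℤ._*_ (at-ghost (λ i → var (0F , i)) ρ) (at-ghost (λ i → var (1F , i)) ρ)))
      ; -‿homo        = λ x → let ρ = single x in
          ≡.trans (≡.sym (at-ghost wittNeg ρ)) (≡.trans (at (ghost-wittNeg n) ρ)
            (≡.cong (ℤ.-_) (at-ghost (λ i → var (0F , i)) ρ)))
      }
      where
      open import Algebra.Properties.Semiring.Exp ℤ.+-*-semiring using (_^_)
      0ⁿ≡0 : ∀ k → .{{ℕ.NonZero k}} → ℤ.0ℤ ^ k ≡ ℤ.0ℤ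
      0ⁿ≡0 (suc k) = ≡.refl
      1ⁿ≡1 : ∀ k → ℤ.1ℤ ^ k ≡ ℤ.1ℤ
      1ⁿ≡1 zero    = ≡.refl
      1ⁿ≡1 (suc k) = ≡.trans (ℤ.*-identityˡ _) (1ⁿ≡1 k)
      p^n≢0 : ∀ {n} → ℕ.NonZero (p ℕ.^ n)
      p^n≢0 {n} = ℕ.m^n≢0 p n {{prime⇒nonZero prime}}
      ghost-0 : ∀ n → ℤᴳ.ghost n (λ _ → ℤ.0ℤ) ≡ ℤ.0ℤ
      ghost-0 zero    = ℤᴳ.ghost-zero (λ _ → ℤ.0ℤ)
      ghost-0 (suc n) = ≡.trans (ℤᴳ.ghost-suc n (λ _ → ℤ.0ℤ)) (≡.cong₂ ℤ._+_
        (0ⁿ≡0 (p ℕ.^ suc n) {{p^n≢0 {suc n}}}) (≡.trans (≡.cong (ℤᴳ.p̂ ℤ.*_) (ghost-0 n)) (ℤ.*-zeroʳ ℤᴳ.p̂)))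
      ghost-1 : ∀ n → ℤᴳ.ghost n (RawRing.1# Wℤ) ≡ ℤ.1ℤ
      ghost-1 zero    = ℤᴳ.ghost-zero (RawRing.1# Wℤ)
      ghost-1 (suc n) = ≡.trans (ℤᴳ.ghost-suc n (RawRing.1# Wℤ)) (≡.cong₂ ℤ._+_
        (1ⁿ≡1 (p ℕ.^ suc n)) (≡.trans (≡.cong (ℤᴳ.p̂ ℤ.*_) (ghost-0 n)) (ℤ.*-zeroʳ ℤᴳ.p̂)))

  module _ {R : RawRing c ℓ} (A : CommutativeRing c′ ℓ′) (h : RawHom R (CommutativeRing.rawRing A)) where
    open CommutativeRing A hiding (zero)
    open EvaluationProperties A using (⟦⟧-cong)
    open RawHom h using (fun; 0-homo; 1-homo; ⟦⟧-homo)

    map-hom : RawHom (wittRawRing R) (wittRawRing rawRing)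
    map-hom = record
      { fun           = λ x → fun ∘ x
      ; isEquivalence = record
        { refl  = λ n → refl
        ; sym   = λ e n → sym (e n)
        ; trans = λ e e′ n → trans (e n) (e′ n)
        }
      ; +-cong        = λ e e′ n → ⟦⟧-cong (wittAdd n) λ { (0F , i) → e i ; (1F , i) → e′ i }
      ; *-cong        = λ e e′ n → ⟦⟧-cong (wittMul n) λ { (0F , i) → e i ; (1F , i) → e′ i }
      ; -‿cong        = λ e n → ⟦⟧-cong (wittNeg n) λ { (0F , i) → e i }
      ; 0-homo        = λ n → 0-homo
      ; 1-homo        = λ { zero → 1-homo ; (suc n) → 0-homo }
      ; +-homo        = λ x y n → trans (⟦⟧-homo (wittAdd n) (pair x y))
          (⟦⟧-cong (wittAdd n) λ { (0F , i) → refl ; (1F , i) → refl })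
      ; *-homo        = λ x y n → trans (⟦⟧-homo (wittMul n) (pair x y))
          (⟦⟧-cong (wittMul n) λ { (0F , i) → refl ; (1F , i) → refl })
      ; -‿homo        = λ x n → trans (⟦⟧-homo (wittNeg n) (single x))
          (⟦⟧-cong (wittNeg n) λ { (0F , i) → refl })
      }

  module _ (A : CommutativeRing c ℓ) where
    open CommutativeRing A hiding (zero)
    private
      WA : RawRing c ℓ
      WA = wittRawRing rawRing

      module W = RawRing WA

      generic : ∀ {m} → Fin m → ℕ → Poly (Fin m × ℕ)
      generic u i = var (u , i)

      ⟦_⟧ᵂ : ∀ {m} → Poly (Fin m) → ℕ → Poly (Fin m × ℕ)
      ⟦ f ⟧ᵂ = ⟦ wittRawRing (CommutativeRing.rawRing ℤ[ _ ]) ⟧ f generic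

    witt-law : ∀ {m} (f g : Poly (Fin m)) → (∀ ρ → ⟦ f ⟧ℤ ρ ≡ ⟦ g ⟧ℤ ρ) →
               ∀ x → ⟦ WA ⟧ f x W.≈ ⟦ WA ⟧ g x
    witt-law {m} f g e x n = trans (sym (RawHom.⟦⟧-homo eval-x f generic n))
      (trans (Transfer.transfer A {f = ⟦ f ⟧ᵂ n} {⟦ g ⟧ᵂ n} (pointwise f≐g) (Product.uncurry x))
        (RawHom.⟦⟧-homo eval-x g generic n))
      where
      eval-x = map-hom A (Transfer.evaluate A (Product.uncurry x))
      f≐g : ∀ ρ → ⟦ ⟦ f ⟧ᵂ n ⟧ℤ ρ ≡ ⟦ ⟦ g ⟧ᵂ n ⟧ℤ ρ
      f≐g ρ = ≡.trans (RawHom.⟦⟧-homo eval-ρ f generic n) (≡.trans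
        (ghost-inj n {⟦ Wℤ ⟧ f y} {⟦ Wℤ ⟧ g y} λ k → ≡.trans (RawHom.⟦⟧-homo (ghost-hom k) f y)
          (≡.trans (e _) (≡.sym (RawHom.⟦⟧-homo (ghost-hom k) g y))))
        (≡.sym (RawHom.⟦⟧-homo eval-ρ g generic n)))
        where
        eval-ρ = map-hom ℤ.+-*-commutativeRing (Transfer.evaluate ℤ.+-*-commutativeRing ρ)
        y : Fin m → ℕ → ℤ
        y u i = ρ (u , i)

    private
      args : W.Carrier → W.Carrier → W.Carrier → Fin 3 → W.Carrier
      args x y z 0F = x
      args x y z 1F = y
      args x y z 2F = z

      a b d : Poly (Fin 3)
      a = var 0F
      b = var 1F
      d = var 2F

      id-hom : RawHom rawRing rawRing
      id-hom = record
        { fun           = id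
        ; isEquivalence = isEquivalence
        ; +-cong        = +-cong
        ; *-cong        = *-cong
        ; -‿cong        = -‿cong
        ; 0-homo        = refl
        ; 1-homo        = refl
        ; +-homo        = λ _ _ → refl
        ; *-homo        = λ _ _ → refl
        ; -‿homo        = λ _ → refl
        }

      module W-cong = RawHom (map-hom A id-hom)

      law₁ : (f g : Poly (Fin 3)) → (∀ ρ → ⟦ f ⟧ℤ ρ ≡ ⟦ g ⟧ℤ ρ) → ∀ x →
             ⟦ WA ⟧ f (args x x x) W.≈ ⟦ WA ⟧ g (args x x x)
      law₁ f g e x = witt-law f g e (args x x x)

    𝕎 : CommutativeRing c ℓ
    𝕎 = record
      { Carrier = W.Carrier
      ; _≈_     = W._≈_
      ; _+_     = W._+_
      ; _*_     = W._*_
      ; -_      = W.-_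
      ; 0#      = W.0#
      ; 1#      = W.1#
      ; isCommutativeRing = record
        { isRing = record
          { +-isAbelianGroup = record
            { isGroup = record
              { isMonoid = record
                { isSemigroup = record
                  { isMagma = record
                    { isEquivalence = W-cong.isEquivalence
                    ; ∙-cong        = W-cong.+-cong
                    }
                  ; assoc = λ x y z → witt-law ((a :+ b) :+ d) (a :+ (b :+ d))
                      (λ ρ → ℤ.+-assoc (ρ 0F) (ρ 1F) (ρ 2F)) (args x y z)
                  }
                ; identity = law₁ (:0 :+ a) a (λ ρ → ℤ.+-identityˡ (ρ 0F))
                           , law₁ (a :+ :0) a (λ ρ → ℤ.+-identityʳ (ρ 0F))
                }
              ; inverse = law₁ (:- a :+ a) :0 (λ ρ → ℤ.+-inverseˡ (ρ 0F))
                        , law₁ (a :+ :- a) :0 (λ ρ → ℤ.+-inverseʳ (ρ 0F))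
              ; ⁻¹-cong = W-cong.-‿cong
              }
            ; comm = λ x y → witt-law (a :+ b) (b :+ a)
                (λ ρ → ℤ.+-comm (ρ 0F) (ρ 1F)) (args x y y)
            }
          ; *-cong     = W-cong.*-cong
          ; *-assoc    = λ x y z → witt-law ((a :* b) :* d) (a :* (b :* d))
              (λ ρ → ℤ.*-assoc (ρ 0F) (ρ 1F) (ρ 2F)) (args x y z)
          ; *-identity = law₁ (:1 :* a) a (λ ρ → ℤ.*-identityˡ (ρ 0F))
                       , law₁ (a :* :1) a (λ ρ → ℤ.*-identityʳ (ρ 0F))
          ; distrib    =
              (λ x y z → witt-law (a :* (b :+ d)) (a :* b :+ a :* d)
                (λ ρ → ℤ.*-distribˡ-+ (ρ 0F) (ρ 1F) (ρ 2F)) (args x y z))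
            , (λ x y z → witt-law ((b :+ d) :* a) (b :* a :+ d :* a)
                (λ ρ → ℤ.*-distribʳ-+ (ρ 0F) (ρ 1F) (ρ 2F)) (args x y z))
          }
        ; *-comm = λ x y → witt-law (a :* b) (b :* a)
            (λ ρ → ℤ.*-comm (ρ 0F) (ρ 1F)) (args x y y)
        }
      }

  -- On W(k), for k of characteristic p, the lift of the Frobenius x ↦ xᵖ of k is W(x ↦ xᵖ).
  module _ (k : CommutativeRing c ℓ) where
    open CommutativeRing k using (semiring)
    open import Algebra.Properties.Semiring.Exp semiring using (_^_)

    frobenius : CommutativeRing.Carrier (𝕎 k) → CommutativeRing.Carrier (𝕎 k)
    frobenius x n = x n ^ p

record IsFiniteField (k : CommutativeRing c ℓ) (q : ℕ) : Set (c ⊔ ℓ) where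
  open CommutativeRing k
  field
    1≉0         : ¬ 1# ≈ 0#
    inverse     : ∀ x → ¬ x ≈ 0# → ∃ λ y → x * y ≈ 1#
    enumeration : Inverse setoid (≡.setoid (Fin q))

freeModule : (R : CommutativeRing c ℓ) → ℕ → LeftModule (CommutativeRing.ring R) c ℓ
freeModule R n = record
  { Carrierᴹ = Vector Carrier n
  ; _≈ᴹ_     = λ x y → ∀ i → x i ≈ y i
  ; _+ᴹ_     = λ x y i → x i + y i
  ; _*ₗ_     = λ a x i → a * x i
  ; 0ᴹ       = λ _ → 0#
  ; -ᴹ_      = λ x i → - x i
  ; isLeftModule = record
    { isLeftSemimodule = record
      { +ᴹ-isCommutativeMonoid = record
        { isMonoid = record
          { isSemigroup = record
            { isMagma = record
              { isEquivalence = record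
                { refl  = λ i → refl
                ; sym   = λ e i → sym (e i)
                ; trans = λ e e′ i → trans (e i) (e′ i)
                }
              ; ∙-cong = λ e e′ i → +-cong (e i) (e′ i)
              }
            ; assoc = λ x y z i → +-assoc (x i) (y i) (z i)
            }
          ; identity = (λ x i → +-identityˡ (x i)) , (λ x i → +-identityʳ (x i))
          }
        ; comm = λ x y i → +-comm (x i) (y i)
        }
      ; isPreleftSemimodule = record
        { *ₗ-cong      = λ e e′ i → *-cong e (e′ i)
        ; *ₗ-zeroˡ     = λ x i → zeroˡ (x i)
        ; *ₗ-distribʳ  = λ x a b i → distribʳ (x i) a b
        ; *ₗ-identityˡ = λ x i → *-identityˡ (x i)
        ; *ₗ-assoc     = λ a b x i → *-assoc a b (x i)
        ; *ₗ-zeroʳ     = λ a i → zeroʳ a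
        ; *ₗ-distribˡ  = λ a x y i → distribˡ a (x i) (y i)
        }
      }
    ; -ᴹ‿cong    = λ e i → -‿cong (e i)
    ; -ᴹ‿inverse = (λ x i → -‿inverseˡ (x i)) , (λ x i → -‿inverseʳ (x i))
    }
  }
  where open CommutativeRing R

module SymplecticLattice
  (R : CommutativeRing c ℓ) (σ : CommutativeRing.Carrier R → CommutativeRing.Carrier R) (p g : ℕ)
  where
  open CommutativeRing R using (_≈_; _+_; _*_; _-_; semiring) renaming (Carrier to Z)
  open import Algebra.Properties.Semiring.Sum semiring using (sum-syntax)

  module D = LeftModule (freeModule R (g ℕ.+ g))
  open D using (_≈ᴹ_; _+ᴹ_; _*ₗ_) renaming (Carrierᴹ to D) public
  open import Algebra.Definitions.RawMonoid D.+ᴹ-rawMonoid using () renaming (_×_ to _·_)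
  open LeftModuleMorphisms D.rawLeftModule D.rawLeftModule using (IsLeftModuleIsomorphism)

  -- The first g basis vectors pair with the last g: ω(eᵢ, e_{g+j}) = δᵢⱼ = - ω(e_{g+j}, eᵢ).
  ω : D → D → Z
  ω x y = ∑[ i < g ] (x (i ↑ˡ g) * y (g ↑ʳ i) - x (g ↑ʳ i) * y (i ↑ˡ g))

  record IsAdditive (F : D → D) : Set (c ⊔ ℓ) where
    field
      cong   : ∀ {x y} → x ≈ᴹ y → F x ≈ᴹ F y
      +-homo : ∀ x y → F (x +ᴹ y) ≈ᴹ F x +ᴹ F y

  record IsSemilinear (F : D → D) : Set (c ⊔ ℓ) where
    field
      isAdditive : IsAdditive F
      semilinear : ∀ a x → F (a *ₗ x) ≈ᴹ σ a *ₗ F x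

  -- σ⁻¹-semilinearity, V (b x) = σ⁻¹(b) V x, with b written as σ a: this is the same when σ is
  -- bijective, as is the Frobenius of the Witt vectors of a finite field.
  record IsInverseSemilinear (V : D → D) : Set (c ⊔ ℓ) where
    field
      isAdditive : IsAdditive V
      semilinear : ∀ a x → V (σ a *ₗ x) ≈ᴹ a *ₗ V x

  record IsPAutodual (F : D → D) : Set (c ⊔ ℓ) where
    field
      isSemilinear        : IsSemilinear F
      V                   : D → D
      isInverseSemilinear : IsInverseSemilinear V
      F∘V≈p               : ∀ x → F (V x) ≈ᴹ p · x
      V∘F≈p               : ∀ x → V (F x) ≈ᴹ p · x
      adjoint             : ∀ x y → ω (F x) y ≈ σ (ω x (V y))

  record IsSymplectic (h : D → D) : Set (c ⊔ ℓ) where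
    field
      isLeftModuleIsomorphism : IsLeftModuleIsomorphism h
      preserves-ω             : ∀ x y → ω (h x) (h y) ≈ ω x y

  infix 4 _∈Sp_Sp
  _∈Sp_Sp : (D → D) → (D → D) → Set (c ⊔ ℓ)
  F ∈Sp F₀ Sp = ∃₂ λ h h′ → IsSymplectic h × IsSymplectic h′ × (∀ x → F x ≈ᴹ h (F₀ (h′ x)))

-- Let F be p-autodual, with dual V.  Vectors xᵢ, zᵢ with ω(xᵢ, xⱼ) = ω(zᵢ, zⱼ) = 0 and
-- ω(F xᵢ, zⱼ) = δᵢⱼ give two hyperbolic systems, (xᵢ, V zᵢ) and (F xᵢ, zᵢ), and F maps the first
-- to the second by xᵢ ↦ F xᵢ and V zᵢ ↦ p zᵢ.  Such a family of size m < g can be enlarged: F does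
-- not vanish mod p on the orthogonal complement of the first system, because there
-- ω(F u, F v) = p σ(ω(u, v)) while ω is nondegenerate.  A family of size g consists of two
-- symplectic bases of D in which F is σ followed by diag(1, …, 1, p, …, p); hence any two
-- p-autodual maps differ by symplectic changes of basis on both sides.  Dimensions over the
-- residue field are compared by counting vectors mod p.
{-# OPTIONS --safe #-}
module Submission where

open import Defs
open import Algebra.Bundles using (CommutativeRing)
import Algebra.Definitions.RawMonoid as RawMonoid
open import Algebra.Module.Bundles using (LeftModule)
open import Algebra.Module.Morphism.Structures using (module LeftModuleMorphisms)
open import Data.Fin.Base
  using (Fin; zero; suc; combine; join; splitAt; _↑ˡ_; _↑ʳ_; punchOut; funToFin; finToFun)
open import Data.Fin.Patterns using (0F; 1F)
open import Data.Fin.Permutation using (permutation)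
open import Data.Fin.Properties
  using (any?; _≟_; splitAt-↑ˡ; splitAt-↑ʳ; join-splitAt; injective⇒≤; punchOut-injective;
         finToFun-funToFin; funToFin-finToFin)
open import Data.Integer.Base as ℤ using (ℤ)
import Data.Integer.Properties as ℤ
open import Data.Nat.Base as ℕ using (ℕ; zero; suc; NonZero; _^_)
import Data.Nat.Properties as ℕ
open import Data.Nat.Primality using (Prime; prime⇒nonZero)
open import Data.Product.Base using (_×_; _,_; proj₁; proj₂; ∃)
open import Data.Sum.Base using (_⊎_; inj₁; inj₂; [_,_]′)
open import Data.Vec.Functional using (Vector; _∷_; _++_)
open import Data.Vec.Functional.Properties using (lookup-++ˡ; lookup-++ʳ)
open import Function.Base using (_∘_)
open import Function.Bundles using (Inverse; _⇔_; mk⇔)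
open import Level using (Level; _⊔_)
open import Relation.Binary.Definitions using (Decidable)
open import Relation.Binary.PropositionalEquality as ≡ using (_≡_; _≢_)
open import Relation.Nullary.Decidable using (yes; no; map′; ¬?; decidable-stable)
open import Relation.Nullary.Negation using (¬_; contradiction)

-- The properties of W(k) and its Frobenius on which the lattice argument rests are collected in
-- `IsWittLike`: p is cancellable, the residues mod p form a finite field, and only 0 is divisible
-- by every power of p. They are derived from the identity p = VF for the Verschiebung V and the
-- Frobenius F of Witt vectors over a finite field.
--
-- The orthogonal complement of a partial system is never given a basis. It is reached through a
-- projection `π`, which needs no denominators because ω is unimodular on the span of the system.
--
-- Counting sees D only mod p. For m < g this suffices, since it has to show only that `π` does not
-- vanish mod p. For m = g it yields no more than π ≡ 0 mod p, whereas a basis of D requires π = 0.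
-- Idempotence closes the gap: writing π u = p h gives π u = π (π u) = p π h, so the divisibility
-- reproduces itself and separation forces π u = 0.

private variable
  c ℓ : Level

-- Counting on finite sets.

injective⇒surjective : ∀ {n} (f : Fin n → Fin n) → (∀ {i j} → f i ≡ f j → i ≡ j) →
                       ∀ j → ∃ λ i → f i ≡ j
injective⇒surjective {suc n} f inj j with any? (λ i → f i ≟ j)
... | yes found = found
-- Punching out a missed value would inject `Fin (suc n)` into `Fin n`.
... | no missed = contradiction
  (injective⇒≤ (λ e → inj (punchOut-injective (missed′ _) (missed′ _) e)))
  ℕ.1+n≰n
  where
  missed′ : ∀ i → ¬ j ≡ f i
  missed′ i e = missed (i , ≡.sym e)

funToFin-cong : ∀ {m n} {f f′ : Fin m → Fin n} → (∀ i → f i ≡ f′ i) → funToFin f ≡ funToFin f′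
funToFin-cong {zero}  e = ≡.refl
funToFin-cong {suc m} e = ≡.cong₂ combine (e zero) (funToFin-cong (e ∘ suc))

++-elim : ∀ {a m n} (P : Fin (m ℕ.+ n) → Set a) →
          (∀ i → P (i ↑ˡ n)) → (∀ i → P (m ↑ʳ i)) → ∀ i → P i
++-elim {m = m} {n} P l r i = ≡.subst P (join-splitAt m n i) (elim (splitAt m i))
  where
  elim : ∀ s → P (join m n s)
  elim (inj₁ i) = l i
  elim (inj₂ i) = r i

distinct⇒1<n : ∀ {n} {i j : Fin n} → i ≢ j → 1 ℕ.< n
distinct⇒1<n {1}           {zero} {zero} i≢j = contradiction ≡.refl i≢j
distinct⇒1<n {suc (suc n)}               i≢j = ℕ.s<s ℕ.z<s

-- Linear maps between free modules.

module Linear (R : CommutativeRing c ℓ) where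
  open CommutativeRing R hiding (zero) renaming (Carrier to Z)
  open import Algebra.Properties.Ring ring using (-1*x≈-x)
  open import Algebra.Properties.Semiring.Mult semiring using () renaming (_×_ to _·_)
  open import Algebra.Properties.Semiring.Sum semiring using (sum; sum-cong-≋; sum-replicate-zero)
  open Congruence R
  open import Relation.Binary.Reasoning.Setoid setoid
  module M {n} = LeftModule (freeModule R n)
  open M using (_≈ᴹ_; _+ᴹ_; _*ₗ_; -ᴹ_; 0ᴹ)

  private variable
    m n o : ℕ

  δ : Fin n → Fin n → Z
  δ zero    zero    = 1#
  δ zero    (suc j) = 0#
  δ (suc i) zero    = 0#
  δ (suc i) (suc j) = δ i j

  δ-sym : ∀ (i j : Fin n) → δ i j ≈ δ j i
  δ-sym zero    zero    = refl
  δ-sym zero    (suc j) = refl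
  δ-sym (suc i) zero    = refl
  δ-sym (suc i) (suc j) = δ-sym i j

  sum-zero : (t : Vector Z n) → (∀ i → t i ≈ 0#) → sum t ≈ 0#
  sum-zero {n} t e = trans (sum-cong-≋ {n} e) (sum-replicate-zero n)

  sum-δ : ∀ (t : Vector Z n) i → sum (λ j → t j * δ i j) ≈ t i
  sum-δ {suc n} t zero = begin
    t zero * 1# + sum (λ j → t (suc j) * 0#)
      ≈⟨ +-cong (*-identityʳ _) (sum-zero (λ j → t (suc j) * 0#) (λ j → zeroʳ _)) ⟩
    t zero + 0# ≈⟨ +-identityʳ _ ⟩
    t zero      ∎
  sum-δ {suc n} t (suc i) = trans (+-cong (zeroʳ _) (sum-δ (t ∘ suc) i)) (+-identityˡ _)

  record IsLinear (L : Vector Z m → Vector Z n) : Set (c ⊔ ℓ) where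
    field
      cong   : ∀ {x y} → x ≈ᴹ y → L x ≈ᴹ L y
      +-homo : ∀ x y → L (x +ᴹ y) ≈ᴹ L x +ᴹ L y
      *-homo : ∀ a x → L (a *ₗ x) ≈ᴹ a *ₗ L x

    neg-homo : ∀ x → L (-ᴹ x) ≈ᴹ -ᴹ L x
    neg-homo x i = begin
      L (-ᴹ x) i          ≈⟨ cong (λ j → sym (-1*x≈-x (x j))) i ⟩
      L (- 1# *ₗ x) i     ≈⟨ *-homo (- 1#) x i ⟩
      - 1# * L x i        ≈⟨ -1*x≈-x (L x i) ⟩
      - L x i             ∎

    0-homo : L 0ᴹ ≈ᴹ 0ᴹ
    0-homo i = begin
      L 0ᴹ i             ≈⟨ cong (λ j → sym (zeroˡ 0#)) i ⟩
      L (0# *ₗ 0ᴹ) i     ≈⟨ *-homo 0# 0ᴹ i ⟩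
      0# * L 0ᴹ i        ≈⟨ zeroˡ _ ⟩
      0#                 ∎

    -- This lets `comb` and `coords` act on residue vectors, which are what counting sees.
    mod-cong : ∀ {q x y} → (∀ i → x i ≡ y i [mod q ]) → ∀ i → L x i ≡ L y i [mod q ]
    mod-cong {q} {x} {y} e i = L h i , (begin
      L x i                ≈⟨ cong (λ j → proj₂ (e j)) i ⟩
      L (y +ᴹ q *ₗ h) i    ≈⟨ +-homo y (q *ₗ h) i ⟩
      L y i + L (q *ₗ h) i ≈⟨ +-congˡ (*-homo q h i) ⟩
      L y i + q * L h i    ∎)
      where
      h : Vector Z _
      h j = proj₁ (e j)

  ∘-linear : {L : Vector Z m → Vector Z n} {K : Vector Z n → Vector Z o} →
             IsLinear L → IsLinear K → IsLinear (K ∘ L)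
  ∘-linear l k = record
    { cong   = λ e → K.cong (L.cong e)
    ; +-homo = λ x y i → trans (K.cong (L.+-homo x y) i) (K.+-homo _ _ i)
    ; *-homo = λ a x i → trans (K.cong (L.*-homo a x) i) (K.*-homo _ _ i)
    }
    where
    module L = IsLinear l
    module K = IsLinear k

  ++-linear : {L : Vector Z o → Vector Z m} {K : Vector Z o → Vector Z n} →
              IsLinear L → IsLinear K → IsLinear (λ x → L x ++ K x)
  ++-linear {m = m} {n = n} l k = record
    { cong   = λ e i → cong′ (splitAt m i) e
    ; +-homo = λ x y i → +-homo′ (splitAt m i) x y
    ; *-homo = λ a x i → *-homo′ (splitAt m i) a x
    }
    where
    module L = IsLinear l
    module K = IsLinear k
    cong′ : ∀ (s : Fin m ⊎ Fin n) {x y} → x ≈ᴹ y → [ _ , _ ]′ s ≈ [ _ , _ ]′ s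
    cong′ (inj₁ i) e = L.cong e i
    cong′ (inj₂ i) e = K.cong e i
    +-homo′ : ∀ (s : Fin m ⊎ Fin n) x y → [ _ , _ ]′ s ≈ [ _ , _ ]′ s + [ _ , _ ]′ s
    +-homo′ (inj₁ i) x y = L.+-homo x y i
    +-homo′ (inj₂ i) x y = K.+-homo x y i
    *-homo′ : ∀ (s : Fin m ⊎ Fin n) a x → [ _ , _ ]′ s ≈ a * [ _ , _ ]′ s
    *-homo′ (inj₁ i) a x = L.*-homo a x i
    *-homo′ (inj₂ i) a x = K.*-homo a x i

  -- `IsPAutodual` expresses p by repeated addition; as a scalar it passes through ω and through
  -- linear maps.
  ×≈*ₗ : ∀ n (x : Vector Z m) → RawMonoid._×_ (M.+ᴹ-rawMonoid {m}) n x ≈ᴹ (n · 1#) *ₗ x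
  ×≈*ₗ zero    x i = sym (zeroˡ _)
  ×≈*ₗ (suc n) x i = begin
    x i + _                        ≈⟨ +-cong (sym (*-identityˡ _)) (×≈*ₗ n x i) ⟩
    1# * x i + (n · 1#) * x i      ≈⟨ distribʳ _ _ _ ⟨
    (1# + n · 1#) * x i            ∎

-- The standard symplectic form and hyperbolic systems in D.

module Form (R : CommutativeRing c ℓ) (σ : CommutativeRing.Carrier R → CommutativeRing.Carrier R)
            (p g : ℕ) where
  open CommutativeRing R hiding (zero) renaming (Carrier to Z)
  open Linear R
  open import Algebra.Properties.Ring ring
    using (-‿distribˡ-*; -‿distribʳ-*; -‿+-comm; -0#≈0#; -‿involutive)
  open import Algebra.Properties.Group +-group using (inverseˡ-unique)
  open import Algebra.Properties.CommutativeSemigroup +-commutativeSemigroup using (interchange)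
  open import Algebra.Properties.Semiring.Sum semiring
    using (sum; sum-cong-≋; ∑-distrib-+; *-distribˡ-sum)
  open import Relation.Binary.Reasoning.Setoid setoid
  open SymplecticLattice R σ p g
  open M {g ℕ.+ g} using (-ᴹ_)

  private
    term : D → D → Fin g → Z
    term x y i = x (i ↑ˡ g) * y (g ↑ʳ i) - x (g ↑ʳ i) * y (i ↑ˡ g)

  ω-cong : ∀ {x x′ y y′} → x ≈ᴹ x′ → y ≈ᴹ y′ → ω x y ≈ ω x′ y′
  ω-cong e e′ = sum-cong-≋ {g} λ i → +-cong (*-cong (e _) (e′ _)) (-‿cong (*-cong (e _) (e′ _)))

  ω-+ˡ : ∀ x x′ y → ω (x +ᴹ x′) y ≈ ω x y + ω x′ y
  ω-+ˡ x x′ y = trans (sum-cong-≋ {g} λ i → begin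
      (x (i ↑ˡ g) + x′ (i ↑ˡ g)) * y (g ↑ʳ i) - (x (g ↑ʳ i) + x′ (g ↑ʳ i)) * y (i ↑ˡ g)
        ≈⟨ +-cong (distribʳ _ _ _) (trans (-‿cong (distribʳ _ _ _)) (sym (-‿+-comm _ _))) ⟩
      (_ + _) + (_ + _) ≈⟨ interchange _ _ _ _ ⟩
      term x y i + term x′ y i ∎)
    (∑-distrib-+ (term x y) (term x′ y))

  ω-*ˡ : ∀ a x y → ω (a *ₗ x) y ≈ a * ω x y
  ω-*ˡ a x y = trans (sum-cong-≋ {g} λ i → begin
      a * x (i ↑ˡ g) * y (g ↑ʳ i) - a * x (g ↑ʳ i) * y (i ↑ˡ g)
        ≈⟨ +-cong (*-assoc _ _ _) (trans (-‿cong (*-assoc _ _ _)) (-‿distribʳ-* _ _)) ⟩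
      _ ≈⟨ distribˡ _ _ _ ⟨
      a * term x y i ∎)
    (sym (*-distribˡ-sum a (term x y)))

  ω-skew : ∀ x y → ω x y ≈ - ω y x
  ω-skew x y = inverseˡ-unique (ω x y) (ω y x) (trans
    (sym (∑-distrib-+ (term x y) (term y x)))
    (sum-zero (λ i → term x y i + term y x i) λ i → begin
      (x (i ↑ˡ g) * y (g ↑ʳ i) - x (g ↑ʳ i) * y (i ↑ˡ g)) +
      (y (i ↑ˡ g) * x (g ↑ʳ i) - y (g ↑ʳ i) * x (i ↑ˡ g))
        ≈⟨ +-congˡ (+-cong (*-comm _ _) (-‿cong (*-comm _ _))) ⟩
      (x (i ↑ˡ g) * y (g ↑ʳ i) - x (g ↑ʳ i) * y (i ↑ˡ g)) +
      (x (g ↑ʳ i) * y (i ↑ˡ g) - x (i ↑ˡ g) * y (g ↑ʳ i))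
        ≈⟨ +-congˡ (+-comm _ _) ⟩
      _ ≈⟨ interchange _ _ _ _ ⟩
      _ ≈⟨ +-cong (-‿inverseʳ _) (-‿inverseˡ _) ⟩
      0# + 0# ≈⟨ +-identityˡ 0# ⟩
      0# ∎))

  -- Computed directly, because skewness alone gives only 2 ω(x, x) = 0.
  ω-alternating : ∀ x → ω x x ≈ 0#
  ω-alternating x = sum-zero (term x x) λ i → trans (+-congʳ (*-comm _ _)) (-‿inverseʳ _)

  ω-+ʳ : ∀ x y y′ → ω x (y +ᴹ y′) ≈ ω x y + ω x y′
  ω-+ʳ x y y′ = begin
    ω x (y +ᴹ y′)         ≈⟨ ω-skew x (y +ᴹ y′) ⟩
    - ω (y +ᴹ y′) x       ≈⟨ -‿cong (ω-+ˡ y y′ x) ⟩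
    - (ω y x + ω y′ x)    ≈⟨ -‿+-comm _ _ ⟨
    - ω y x + - ω y′ x    ≈⟨ +-cong (ω-skew x y) (ω-skew x y′) ⟨
    ω x y + ω x y′        ∎

  ω-*ʳ : ∀ a x y → ω x (a *ₗ y) ≈ a * ω x y
  ω-*ʳ a x y = begin
    ω x (a *ₗ y)     ≈⟨ ω-skew x (a *ₗ y) ⟩
    - ω (a *ₗ y) x   ≈⟨ -‿cong (ω-*ˡ a y x) ⟩
    - (a * ω y x)    ≈⟨ -‿distribʳ-* a _ ⟩
    a * - ω y x      ≈⟨ *-congˡ (ω-skew x y) ⟨
    a * ω x y        ∎

  ω-skew₀ : ∀ x y → ω x y ≈ 0# → ω y x ≈ 0#
  ω-skew₀ x y e = trans (ω-skew y x) (trans (-‿cong e) -0#≈0#)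

  ω-linearˡ : ∀ {n} (v : Vector D n) → IsLinear (λ u i → ω u (v i))
  ω-linearˡ v = record
    { cong   = λ e i → ω-cong {y = v i} e (λ _ → refl)
    ; +-homo = λ x y i → ω-+ˡ x y (v i)
    ; *-homo = λ a x i → ω-*ˡ a x (v i)
    }

  ω-linearʳ : ∀ {n} (v : Vector D n) → IsLinear (λ u i → ω (v i) u)
  ω-linearʳ v = record
    { cong   = λ e i → ω-cong {v i} (λ _ → refl) e
    ; +-homo = λ x y i → ω-+ʳ (v i) x y
    ; *-homo = λ a x i → ω-*ʳ a (v i) x
    }

  -- The standard basis with its halves exchanged, up to sign: e_{g+i} reads coordinate i and -eᵢ
  -- reads coordinate g + i. This is where perfectness of ω enters.
  dual : Fin (g ℕ.+ g) → D
  dual l = [ (λ i → (λ _ → 0#) ++ δ i) , (λ i → (λ j → - δ i j) ++ (λ _ → 0#)) ]′ (splitAt g l)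

  ω-dual : ∀ x l → ω x (dual l) ≈ x l
  ω-dual x = ++-elim (λ l → ω x (dual l) ≈ x l) left right
    where
    left : ∀ i → ω x (dual (i ↑ˡ g)) ≈ x (i ↑ˡ g)
    left i rewrite splitAt-↑ˡ g i g = trans (sum-cong-≋ {g} λ j → begin
      x (j ↑ˡ g) * _ - x (g ↑ʳ j) * _
        ≈⟨ +-cong (*-congˡ (reflexive (lookup-++ʳ {m = g} (λ _ → 0#) (δ i) j)))
             (-‿cong (*-congˡ (reflexive (lookup-++ˡ {m = g} (λ _ → 0#) (δ i) j)))) ⟩
      x (j ↑ˡ g) * δ i j - x (g ↑ʳ j) * 0#
        ≈⟨ +-congˡ (trans (-‿cong (zeroʳ _)) -0#≈0#) ⟩
      x (j ↑ˡ g) * δ i j + 0#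
        ≈⟨ +-identityʳ _ ⟩
      x (j ↑ˡ g) * δ i j ∎)
      (sum-δ (λ j → x (j ↑ˡ g)) i)
    right : ∀ i → ω x (dual (g ↑ʳ i)) ≈ x (g ↑ʳ i)
    right i rewrite splitAt-↑ʳ g g i = trans (sum-cong-≋ {g} λ j → begin
      x (j ↑ˡ g) * _ - x (g ↑ʳ j) * _
        ≈⟨ +-cong (*-congˡ (reflexive (lookup-++ʳ {m = g} (λ j → - δ i j) (λ _ → 0#) j)))
             (-‿cong (*-congˡ (reflexive (lookup-++ˡ {m = g} (λ j → - δ i j) (λ _ → 0#) j)))) ⟩
      x (j ↑ˡ g) * 0# - x (g ↑ʳ j) * - δ i j
        ≈⟨ +-cong (zeroʳ _) (trans (-‿distribʳ-* _ _) (*-congˡ (-‿involutive _))) ⟩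
      0# + x (g ↑ʳ j) * δ i j
        ≈⟨ +-identityˡ _ ⟩
      x (g ↑ʳ j) * δ i j ∎)
      (sum-δ (λ j → x (g ↑ʳ j)) i)

  module Dᴹ = M {g ℕ.+ g}
  open import Algebra.Properties.CommutativeMonoid.Sum Dᴹ.+ᴹ-commutativeMonoid public using ()
    renaming (sum to sumᴰ; sum-cong-≋ to sumᴰ-cong; ∑-distrib-+ to sumᴰ-+)

  sumᴰ-* : ∀ {n} a (v : Vector D n) → sumᴰ (λ i → a *ₗ v i) ≈ᴹ a *ₗ sumᴰ v
  sumᴰ-* {zero}  a v i = sym (zeroʳ a)
  sumᴰ-* {suc n} a v i = trans (+-congˡ (sumᴰ-* a (v ∘ suc) i)) (sym (distribˡ _ _ _))

  ω-sumˡ : ∀ {n} (v : Vector D n) y → ω (sumᴰ v) y ≈ sum (λ i → ω (v i) y)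
  ω-sumˡ {zero}  v y = sum-zero (term Dᴹ.0ᴹ y) λ i → trans
    (+-cong (zeroˡ _) (trans (-‿cong (zeroˡ _)) -0#≈0#)) (+-identityˡ _)
  ω-sumˡ {suc n} v y = trans (ω-+ˡ (v zero) (sumᴰ (v ∘ suc)) y) (+-congˡ (ω-sumˡ (v ∘ suc) y))

  additive-sum : ∀ {F : D → D} → IsAdditive F → ∀ {n} (v : Vector D n) → F (sumᴰ v) ≈ᴹ sumᴰ (F ∘ v)
  additive-sum {F} a {zero} v i = F0≈0
    where
    open IsAdditive a
    open import Algebra.Properties.Group +-group using (identityʳ-unique)
    F0≈0 : F Dᴹ.0ᴹ i ≈ 0#
    F0≈0 = identityʳ-unique _ _ (trans (sym (+-homo Dᴹ.0ᴹ Dᴹ.0ᴹ i)) (cong (λ _ → +-identityˡ 0#) i))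
  additive-sum a {suc n} v i = trans (+-homo (v zero) (sumᴰ (v ∘ suc)) i)
    (+-congˡ (additive-sum a (v ∘ suc) i))
    where open IsAdditive a

  -- A partial symplectic basis: ω has the standard Gram matrix on these 2m vectors, so `comb`
  -- embeds the standard symplectic lattice of rank 2m isometrically.
  record HyperbolicSystem (m : ℕ) : Set (c ⊔ ℓ) where
    field
      x x′ : Fin m → D
      ω-xx   : ∀ i j → ω (x i) (x j) ≈ 0#
      ω-x′x′ : ∀ i j → ω (x′ i) (x′ j) ≈ 0#
      ω-xx′  : ∀ i j → ω (x i) (x′ j) ≈ δ i j

    open SymplecticLattice R σ p m using () renaming (ω to ωₘ)

    comb : Vector Z (m ℕ.+ m) → D
    comb a = sumᴰ (λ i → a (i ↑ˡ m) *ₗ x i +ᴹ a (m ↑ʳ i) *ₗ x′ i)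

    -- If u is a combination of the system, pairing with x′ᵢ isolates the coefficient of xᵢ, and
    -- pairing xᵢ with u that of x′ᵢ. For other u these are the coefficients of its orthogonal
    -- projection to the span.
    coords : D → Vector Z (m ℕ.+ m)
    coords u = (λ i → ω u (x′ i)) ++ (λ i → ω (x i) u)

    coordsˡ : ∀ u i → coords u (i ↑ˡ m) ≈ ω u (x′ i)
    coordsˡ u i = reflexive (lookup-++ˡ (λ i → ω u (x′ i)) (λ i → ω (x i) u) i)

    coordsʳ : ∀ u i → coords u (m ↑ʳ i) ≈ ω (x i) u
    coordsʳ u i = reflexive (lookup-++ʳ (λ i → ω u (x′ i)) (λ i → ω (x i) u) i)

    comb-linear : IsLinear comb
    comb-linear = record
      { cong   = λ e → sumᴰ-cong {m} λ i l → +-cong (*-congʳ (e (i ↑ˡ m))) (*-congʳ (e (m ↑ʳ i)))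
      ; +-homo = λ a b l → trans
          (sumᴰ-cong {m} (λ i l →
            trans (+-cong (distribʳ _ _ _) (distribʳ _ _ _)) (interchange _ _ _ _)) l)
          (sumᴰ-+ {m} (λ i → a (i ↑ˡ m) *ₗ x i +ᴹ a (m ↑ʳ i) *ₗ x′ i)
             (λ i → b (i ↑ˡ m) *ₗ x i +ᴹ b (m ↑ʳ i) *ₗ x′ i) l)
      ; *-homo = λ b a l → trans
          (sumᴰ-cong {m} (λ i l →
            trans (+-cong (*-assoc _ _ _) (*-assoc _ _ _)) (sym (distribˡ _ _ _))) l)
          (sumᴰ-* b (λ i → a (i ↑ˡ m) *ₗ x i +ᴹ a (m ↑ʳ i) *ₗ x′ i) l)
      }

    coords-linear : IsLinear coords
    coords-linear = ++-linear (ω-linearˡ x′) (ω-linearʳ x)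

    -- Adjointness of `comb` and `coords`, the one computation behind `coords-comb`, `ω-πʳ` and
    -- `ω-comb-comb`.
    ω-comb : ∀ a u → ω (comb a) u ≈ ωₘ a (coords u)
    ω-comb a u = trans (ω-sumˡ (λ i → a (i ↑ˡ m) *ₗ x i +ᴹ a (m ↑ʳ i) *ₗ x′ i) u)
      (sum-cong-≋ {m} λ i → begin
      ω (a (i ↑ˡ m) *ₗ x i +ᴹ a (m ↑ʳ i) *ₗ x′ i) u
        ≈⟨ ω-+ˡ (a (i ↑ˡ m) *ₗ x i) (a (m ↑ʳ i) *ₗ x′ i) u ⟩
      ω (a (i ↑ˡ m) *ₗ x i) u + ω (a (m ↑ʳ i) *ₗ x′ i) u
        ≈⟨ +-cong (ω-*ˡ _ (x i) u) (ω-*ˡ _ (x′ i) u) ⟩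
      a (i ↑ˡ m) * ω (x i) u + a (m ↑ʳ i) * ω (x′ i) u
        ≈⟨ +-congˡ (*-congˡ (ω-skew (x′ i) u)) ⟩
      a (i ↑ˡ m) * ω (x i) u + a (m ↑ʳ i) * - ω u (x′ i)
        ≈⟨ +-cong (*-congˡ (coordsʳ u i))
             (trans (-‿distribʳ-* _ _) (*-congˡ (-‿cong (coordsˡ u i)))) ⟨
      a (i ↑ˡ m) * coords u (m ↑ʳ i) - a (m ↑ʳ i) * coords u (i ↑ˡ m) ∎)

    private
      sum-coords : ∀ (a : Vector Z (m ℕ.+ m)) (b d : Vector Z m) u →
                   (∀ i → coords u (i ↑ˡ m) ≈ b i) → (∀ i → coords u (m ↑ʳ i) ≈ d i) →
                   ωₘ a (coords u) ≈ sum (λ i → a (i ↑ˡ m) * d i - a (m ↑ʳ i) * b i)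
      sum-coords a b d u eb ed = sum-cong-≋ {m} λ i →
        +-cong (*-congˡ (ed i)) (-‿cong (*-congˡ (eb i)))

    coords-comb : ∀ a l → coords (comb a) l ≈ a l
    coords-comb a = ++-elim (λ l → coords (comb a) l ≈ a l) left right
      where
      left : ∀ i → coords (comb a) (i ↑ˡ m) ≈ a (i ↑ˡ m)
      left i = begin
        coords (comb a) (i ↑ˡ m)  ≈⟨ coordsˡ (comb a) i ⟩
        ω (comb a) (x′ i)         ≈⟨ ω-comb a (x′ i) ⟩
        _                         ≈⟨ sum-coords a (λ _ → 0#) (λ j → δ i j) (x′ i)
                                       (λ j → trans (coordsˡ (x′ i) j) (ω-x′x′ i j))
                                       (λ j → trans (coordsʳ (x′ i) j)
                                         (trans (ω-xx′ j i) (δ-sym j i))) ⟩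
        _                         ≈⟨ sum-cong-≋ {m} (λ j → trans
                                       (+-congˡ (trans (-‿cong (zeroʳ _)) -0#≈0#)) (+-identityʳ _)) ⟩
        _                         ≈⟨ sum-δ (λ j → a (j ↑ˡ m)) i ⟩
        a (i ↑ˡ m)                ∎
      right : ∀ i → coords (comb a) (m ↑ʳ i) ≈ a (m ↑ʳ i)
      right i = begin
        coords (comb a) (m ↑ʳ i)  ≈⟨ coordsʳ (comb a) i ⟩
        ω (x i) (comb a)          ≈⟨ ω-skew (x i) (comb a) ⟩
        - ω (comb a) (x i)        ≈⟨ -‿cong (ω-comb a (x i)) ⟩
        _                         ≈⟨ -‿cong (sum-coords a (λ j → δ i j) (λ _ → 0#) (x i)
                                       (λ j → trans (coordsˡ (x i) j) (ω-xx′ i j))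
                                       (λ j → trans (coordsʳ (x i) j) (ω-xx j i))) ⟩
        _                         ≈⟨ -‿cong (sum-cong-≋ {m} (λ j → trans
                                       (+-cong (zeroʳ _) (-‿distribˡ-* _ _)) (+-identityˡ _))) ⟩
        _                         ≈⟨ -‿cong (sum-δ (λ j → - a (m ↑ʳ j)) i) ⟩
        - - a (m ↑ʳ i)            ≈⟨ -‿involutive _ ⟩
        a (m ↑ʳ i)                ∎

    -- The orthogonal projection onto the complement of the span.
    π : D → D
    π u = u +ᴹ -ᴹ comb (coords u)

    π-linear : IsLinear π
    π-linear = record
      { cong   = λ e l → +-cong (e l) (-‿cong (cc.cong e l))
      ; +-homo = λ u v l → trans (+-congˡ (trans (-‿cong (cc.+-homo u v l)) (sym (-‿+-comm _ _))))
          (interchange _ _ _ _)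
      ; *-homo = λ a u l → trans (+-congˡ (trans (-‿cong (cc.*-homo a u l)) (-‿distribʳ-* _ _)))
          (sym (distribˡ _ _ _))
      }
      where module cc = IsLinear (∘-linear coords-linear comb-linear)

    comb+π : ∀ u → comb (coords u) +ᴹ π u ≈ᴹ u
    comb+π u l = begin
      q + (u l - q)   ≈⟨ +-congˡ (+-comm _ _) ⟩
      q + (- q + u l) ≈⟨ +-assoc _ _ _ ⟨
      q - q + u l     ≈⟨ +-congʳ (-‿inverseʳ q) ⟩
      0# + u l        ≈⟨ +-identityˡ _ ⟩
      u l             ∎
      where q = comb (coords u) l

    coords-π : ∀ u l → coords (π u) l ≈ 0#
    coords-π u l = begin
      coords (u +ᴹ -ᴹ comb (coords u)) l            ≈⟨ +-homo u (-ᴹ comb (coords u)) l ⟩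
      coords u l + coords (-ᴹ comb (coords u)) l    ≈⟨ +-congˡ (neg-homo (comb (coords u)) l) ⟩
      coords u l - coords (comb (coords u)) l       ≈⟨ +-congˡ (-‿cong (coords-comb (coords u) l)) ⟩
      coords u l - coords u l                       ≈⟨ -‿inverseʳ _ ⟩
      0#                                            ∎
      where open IsLinear coords-linear

    π-fixed : ∀ u → (∀ l → coords u l ≈ 0#) → π u ≈ᴹ u
    π-fixed u e l = begin
      u l - comb (coords u) l ≈⟨ +-congˡ (-‿cong (trans (cong e l) (0-homo l))) ⟩
      u l - 0#                ≈⟨ +-congˡ -0#≈0# ⟩
      u l + 0#                ≈⟨ +-identityʳ _ ⟩
      u l                     ∎
      where open IsLinear comb-linear

    π-comb : ∀ a → π (comb a) ≈ᴹ Dᴹ.0ᴹ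
    π-comb a l = trans (+-congˡ (-‿cong (IsLinear.cong comb-linear (coords-comb a) l))) (-‿inverseʳ _)

    -- A vector with vanishing coordinates is orthogonal to the span, hence does not see the part of
    -- v that `π` removes.
    ω-πʳ : ∀ w → (∀ l → coords w l ≈ 0#) → ∀ v → ω w (π v) ≈ ω w v
    ω-πʳ w e v = begin
      ω w (π v)                       ≈⟨ +-identityˡ _ ⟨
      0# + ω w (π v)                  ≈⟨ +-congʳ zero-pairing ⟨
      ω w (comb (coords v)) + ω w (π v) ≈⟨ ω-+ʳ w (comb (coords v)) (π v) ⟨
      ω w (comb (coords v) +ᴹ π v)    ≈⟨ ω-cong {x = w} (λ _ → refl) (comb+π v) ⟩
      ω w v                           ∎
      where
      zero-pairing : ω w (comb (coords v)) ≈ 0#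
      zero-pairing = ω-skew₀ (comb (coords v)) w (trans (ω-comb (coords v) w)
        (sum-zero (λ i → coords v (i ↑ˡ m) * coords w (m ↑ʳ i) - coords v (m ↑ʳ i) * coords w (i ↑ˡ m))
          λ i → trans (+-cong (trans (*-congˡ (e _)) (zeroʳ _))
            (trans (-‿cong (trans (*-congˡ (e _)) (zeroʳ _))) -0#≈0#)) (+-identityˡ _)))

    π-adjoint : ∀ u v → ω (π u) v ≈ ω u (π v)
    π-adjoint u v = begin
      ω (π u) v       ≈⟨ ω-πʳ (π u) (coords-π u) v ⟨
      ω (π u) (π v)   ≈⟨ ω-skew (π u) (π v) ⟩
      - ω (π v) (π u) ≈⟨ -‿cong (ω-πʳ (π v) (coords-π v) u) ⟩
      - ω (π v) u     ≈⟨ ω-skew u (π v) ⟨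
      ω u (π v)       ∎

    ω-comb-comb : ∀ a b → ω (comb a) (comb b) ≈ ωₘ a b
    ω-comb-comb a b = trans (ω-comb a (comb b)) (sum-cong-≋ {m} λ i →
      +-cong (*-congˡ (coords-comb b _)) (-‿cong (*-congˡ (coords-comb b _))))

  changeBasis : (s t : HyperbolicSystem g) → D → D
  changeBasis s t u = HyperbolicSystem.comb t (HyperbolicSystem.coords s u)

  -- Injectivity of `comb` is formal, by `coords-comb`. Surjectivity in size g is not; it is assumed
  -- here and established by counting in `spanning`.
  Spanning : HyperbolicSystem g → Set (c ⊔ ℓ)
  Spanning s = ∀ u → HyperbolicSystem.comb s (HyperbolicSystem.coords s u) ≈ᴹ u

  changeBasis-inverse : ∀ s t → Spanning s → ∀ u → changeBasis t s (changeBasis s t u) ≈ᴹ u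
  changeBasis-inverse s t span u l = trans
    (IsLinear.cong S.comb-linear (T.coords-comb (S.coords u)) l) (span u l)
    where
    module S = HyperbolicSystem s
    module T = HyperbolicSystem t

  changeBasis-symplectic : ∀ s t → Spanning s → Spanning t → IsSymplectic (changeBasis s t)
  changeBasis-symplectic s t span-s span-t = record
    { isLeftModuleIsomorphism = record
      { isLeftModuleMonomorphism = record
        { isLeftModuleHomomorphism = record
          { +ᴹ-isGroupHomomorphism = record
            { isMonoidHomomorphism = record
              { isMagmaHomomorphism = record
                { isRelHomomorphism = record { cong = L.cong }
                ; homo = L.+-homo
                }
              ; ε-homo = L.0-homo
              }
            ; ⁻¹-homo = L.neg-homo
            }
          ; *ₗ-homo = L.*-homo
          }
        ; injective = λ {u} {v} e → Dᴹ.≈ᴹ-trans (Dᴹ.≈ᴹ-sym (changeBasis-inverse s t span-s u))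
            (Dᴹ.≈ᴹ-trans (L⁻¹.cong e) (changeBasis-inverse s t span-s v))
        }
      ; surjective = λ u → changeBasis t s u ,
          λ e → Dᴹ.≈ᴹ-trans (L.cong e) (changeBasis-inverse t s span-t u)
      }
    ; preserves-ω = λ u v → begin
        ω (changeBasis s t u) (changeBasis s t v)       ≈⟨ T.ω-comb-comb (S.coords u) (S.coords v) ⟩
        -- In size g the form on coordinates is `ω` itself, so the two isometries can be composed
        -- here.
        ω (S.coords u) (S.coords v)                     ≈⟨ S.ω-comb-comb (S.coords u) (S.coords v) ⟨
        ω (S.comb (S.coords u)) (S.comb (S.coords v))   ≈⟨ ω-cong (span-s u) (span-s v) ⟩
        ω u v                                           ∎
    }
    where
    module S = HyperbolicSystem s
    module T = HyperbolicSystem t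
    module L = IsLinear (∘-linear S.coords-linear T.comb-linear)
    module L⁻¹ = IsLinear (∘-linear T.coords-linear S.comb-linear)

-- The properties required of the Witt vectors.

module _ (R : CommutativeRing c ℓ) (σ : CommutativeRing.Carrier R → CommutativeRing.Carrier R)
         (p N : ℕ) where
  open CommutativeRing R hiding (zero) renaming (Carrier to Z)
  open Congruence R
  open import Algebra.Properties.Semiring.Mult semiring using () renaming (_×_ to _·_)
  open import Algebra.Properties.Semiring.Exp semiring using () renaming (_^_ to _^ᴿ_)
  open import Algebra.Properties.Group +-group using (identityʳ-unique)

  -- R behaves like the Witt vectors of a finite field with N elements, and σ like their Frobenius.
  record IsWittLike : Set (c ⊔ ℓ) where
    p̂ : Z
    p̂ = p · 1#

    field
      σ-cong         : ∀ {a b} → a ≈ b → σ a ≈ σ b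
      σ-+            : ∀ a b → σ (a + b) ≈ σ a + σ b
      σ-*            : ∀ a b → σ (a * b) ≈ σ a * σ b
      σ-1            : σ 1# ≈ 1#
      σ-injective    : ∀ {a b} → σ a ≈ σ b → a ≈ b
      σ-reflects-p   : ∀ {a} → σ a ≡ 0# [mod p̂ ] → a ≡ 0# [mod p̂ ]
      p̂-cancel       : ∀ {a b} → p̂ * a ≈ p̂ * b → a ≈ b
      p-separated    : ∀ {a} → (∀ n → ∃ λ h → a ≈ p̂ ^ᴿ n * h) → a ≈ 0#
      inverse        : ∀ {a} → ¬ a ≡ 0# [mod p̂ ] → ∃ λ b → a * b ≈ 1#
      -- `code` and `decode` present the residue ring mod p as `Fin N`, so that residues can be
      -- counted and compared decidably without forming a quotient.
      code           : Z → Fin N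
      decode         : Fin N → Z
      code-cong      : ∀ {a b} → a ≡ b [mod p̂ ] → code a ≡ code b
      code-injective : ∀ {a b} → code a ≡ code b → a ≡ b [mod p̂ ]
      code-decode    : ∀ i → code (decode i) ≡ i
      1<N            : 1 ℕ.< N

    σ-0 : σ 0# ≈ 0#
    σ-0 = identityʳ-unique _ _ (trans (sym (σ-+ 0# 0#)) (σ-cong (+-identityˡ 0#)))

    σ-p̂ : σ p̂ ≈ p̂
    σ-p̂ = go p
      where
      go : ∀ n → σ (n · 1#) ≈ n · 1#
      go zero    = σ-0
      go (suc n) = trans (σ-+ _ _) (+-cong σ-1 (go n))

-- Counting residues, and why hyperbolic systems of size g span D.

module DoubleCoset (R : CommutativeRing c ℓ)
                   (σ : CommutativeRing.Carrier R → CommutativeRing.Carrier R)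
                   (p g : ℕ) {N : ℕ} (wittLike : IsWittLike R σ p N) where
  open CommutativeRing R hiding (zero) renaming (Carrier to Z)
  open Congruence R
  open import Algebra.Properties.Semiring.Exp semiring using () renaming (_^_ to _^ᴿ_)
  open import Relation.Binary.Reasoning.Setoid setoid
  open Linear R
  open Form R σ p g
  open SymplecticLattice R σ p g
  open IsWittLike wittLike

  infix 4 _∼_
  _∼_ : ∀ {n} → Vector Z n → Vector Z n → Set (c ⊔ ℓ)
  u ∼ v = ∀ i → u i ≡ v i [mod p̂ ]

  encode : ∀ {n} → Vector Z n → Fin (N ^ n)
  encode u = funToFin (code ∘ u)

  represent : ∀ {n} → Fin (N ^ n) → Vector Z n
  represent i = decode ∘ finToFun i

  encode-injective : ∀ {n} {u v : Vector Z n} → encode u ≡ encode v → u ∼ v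
  encode-injective {u = u} {v} e i = code-injective (≡.trans (≡.sym (finToFun-funToFin (code ∘ u) i))
    (≡.trans (≡.cong (λ k → finToFun k i) e) (finToFun-funToFin (code ∘ v) i)))

  represent-injective : ∀ {n} {i j : Fin (N ^ n)} → represent {n} i ∼ represent j → i ≡ j
  represent-injective {n} {i} {j} e = ≡.trans (≡.sym (funToFin-finToFin {n} {N} i)) (≡.trans
    (funToFin-cong λ l → ≡.trans (≡.sym (code-decode _)) (≡.trans (code-cong (e l)) (code-decode _)))
    (funToFin-finToFin {n} {N} j))

  module _ {m : ℕ} (s : HyperbolicSystem m) where
    open HyperbolicSystem s

    ∼-comb-coords : (∀ u → π u ∼ Dᴹ.0ᴹ) → ∀ u → u ∼ comb (coords u)
    ∼-comb-coords π∼0 u l = ≡-trans (≈⇒≡ (sym (comb+π u l)))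
      (≡-trans (≡-+ (≈⇒≡ refl) (π∼0 u l)) (≈⇒≡ (+-identityʳ _)))

    -- Otherwise a residue vector would be determined by its coordinates, but there are N^(2g) of
    -- the former and only N^(2m) of the latter.
    ¬spanning-mod-p : m ℕ.< g → ¬ (∀ u → π u ∼ Dᴹ.0ᴹ)
    ¬spanning-mod-p m<g π∼0 = ℕ.<⇒≱ (ℕ.^-monoʳ-< N 1<N (ℕ.+-mono-< m<g m<g))
      (injective⇒≤ {f = encode ∘ coords ∘ represent {g ℕ.+ g}} λ e → represent-injective λ l →
        ≡-trans (∼-comb-coords π∼0 _ l) (≡-trans
          (IsLinear.mod-cong comb-linear (encode-injective e) l)
          (≡-sym (∼-comb-coords π∼0 _ l))))

  -- Mod p, `comb` is injective because `coords` inverts it, hence surjective between sets of equal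
  -- size, and `π` kills its image. So π ≡ 0 mod p, and idempotence of `π` raises this to every
  -- power of p.
  π≈0 : (s : HyperbolicSystem g) → ∀ u → HyperbolicSystem.π s u ≈ᴹ Dᴹ.0ᴹ
  π≈0 s u l = p-separated λ n → proj₁ (divisible n u) l , proj₂ (divisible n u) l
    where
    open HyperbolicSystem s
    module π = IsLinear π-linear
    π∼0 : ∀ u → π u ∼ Dᴹ.0ᴹ
    π∼0 u l = ≡-trans (π.mod-cong {x = u} {comb (represent i)} u∼ l) (≈⇒≡ (π-comb (represent i) l))
      where
      preimage = injective⇒surjective (encode ∘ comb ∘ represent {g ℕ.+ g})
        (λ e → represent-injective λ l → ≡-trans (≈⇒≡ (sym (coords-comb _ l))) (≡-trans
          (IsLinear.mod-cong coords-linear (encode-injective e) l) (≈⇒≡ (coords-comb _ l))))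
        (encode u)
      i = proj₁ preimage
      u∼ : u ∼ comb (represent i)
      u∼ = encode-injective (≡.sym (proj₂ preimage))
    divisible : ∀ n u → ∃ λ h → π u ≈ᴹ (p̂ ^ᴿ n) *ₗ h
    divisible zero    u = π u , λ l → sym (*-identityˡ _)
    divisible (suc n) u = proj₁ (divisible n h) , λ l → begin
      π u l                               ≈⟨ π-fixed (π u) (coords-π u) l ⟨
      π (π u) l                           ≈⟨ π.cong (λ l → trans (proj₂ (π∼0 u l)) (+-identityˡ _)) l ⟩
      π (p̂ *ₗ h) l                        ≈⟨ π.*-homo p̂ h l ⟩
      p̂ * π h l                           ≈⟨ *-congˡ (proj₂ (divisible n h) l) ⟩
      p̂ * (p̂ ^ᴿ n * _)                    ≈⟨ *-assoc _ _ _ ⟨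
      p̂ * p̂ ^ᴿ n * _                      ∎
      where
      h : D
      h l = proj₁ (π∼0 u l)

  spanning : (s : HyperbolicSystem g) → Spanning s
  spanning s u l = trans (sym (+-identityʳ _)) (trans (+-congˡ (sym (π≈0 s u l))) (comb+π u l))
    where open HyperbolicSystem s

  σ-δ : ∀ {n} (i j : Fin n) → σ (δ i j) ≈ δ i j
  σ-δ zero    zero    = σ-1
  σ-δ zero    (suc j) = σ-0
  σ-δ (suc i) zero    = σ-0
  σ-δ (suc i) (suc j) = σ-δ i j

  -- Adapted systems of an autodual map.

  module Autodual {F : D → D} (autodual : IsPAutodual F) where
    open IsPAutodual autodual public
    open IsSemilinear isSemilinear public
    open IsInverseSemilinear isInverseSemilinear public using ()
      renaming (isAdditive to V-isAdditive; semilinear to V-semilinear)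
    module F = IsAdditive isAdditive
    module V = IsAdditive V-isAdditive

    FV≈p̂ : ∀ u → F (V u) ≈ᴹ p̂ *ₗ u
    FV≈p̂ u l = trans (F∘V≈p u l) (×≈*ₗ p u l)

    VF≈p̂ : ∀ u → V (F u) ≈ᴹ p̂ *ₗ u
    VF≈p̂ u l = trans (V∘F≈p u l) (×≈*ₗ p u l)

    ω-FF : ∀ u v → ω (F u) (F v) ≈ p̂ * σ (ω u v)
    ω-FF u v = begin
      ω (F u) (F v)       ≈⟨ adjoint u (F v) ⟩
      σ (ω u (V (F v)))   ≈⟨ σ-cong (ω-cong {x = u} (λ _ → refl) (VF≈p̂ v)) ⟩
      σ (ω u (p̂ *ₗ v))    ≈⟨ σ-cong (ω-*ʳ p̂ u v) ⟩
      σ (p̂ * ω u v)       ≈⟨ σ-* _ _ ⟩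
      σ p̂ * σ (ω u v)     ≈⟨ *-congʳ σ-p̂ ⟩
      p̂ * σ (ω u v)       ∎

    ω-FF₀ : ∀ u v → ω u v ≈ 0# → ω (F u) (F v) ≈ 0#
    ω-FF₀ u v e = trans (ω-FF u v) (trans (*-congˡ (trans (σ-cong e) σ-0)) (zeroʳ _))

    record AdaptedSystem (m : ℕ) : Set (c ⊔ ℓ) where
      field
        x z   : Fin m → D
        ω-xx  : ∀ i j → ω (x i) (x j) ≈ 0#
        ω-zz  : ∀ i j → ω (z i) (z j) ≈ 0#
        ω-Fxz : ∀ i j → ω (F (x i)) (z j) ≈ δ i j

      source target : HyperbolicSystem m
      source = record
        { x = x ; x′ = V ∘ z ; ω-xx = ω-xx
        -- Adjunction gives pairings with values of V only under σ, hence `σ-injective`; here σ(ω(V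
        -- zᵢ, V zⱼ)) = p ω(zᵢ, zⱼ).
        ; ω-x′x′ = λ i j → σ-injective (begin
            σ (ω (V (z i)) (V (z j))) ≈⟨ adjoint (V (z i)) (z j) ⟨
            ω (F (V (z i))) (z j)     ≈⟨ ω-cong {y = z j} (FV≈p̂ (z i)) (λ _ → refl) ⟩
            ω (p̂ *ₗ z i) (z j)        ≈⟨ ω-*ˡ p̂ (z i) (z j) ⟩
            p̂ * ω (z i) (z j)         ≈⟨ trans (*-congˡ (ω-zz i j)) (zeroʳ p̂) ⟩
            0#                        ≈⟨ σ-0 ⟨
            σ 0#                      ∎)
        ; ω-xx′ = λ i j → σ-injective
            (trans (sym (adjoint (x i) (z j))) (trans (ω-Fxz i j) (sym (σ-δ i j))))
        }
      target = record
        { x = F ∘ x ; x′ = z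
        ; ω-xx = λ i j → ω-FF₀ (x i) (x j) (ω-xx i j)
        ; ω-x′x′ = ω-zz
        ; ω-xx′ = ω-Fxz
        }

      module S = HyperbolicSystem source
      module T = HyperbolicSystem target

      -- F respects the two complements: pairings with zᵢ are controlled by adjunction, those with F
      -- xᵢ by `ω-FF`. Therefore a vector chosen in the complement of `source` is admissible for
      -- both systems at once.
      coords-F : ∀ u → (∀ l → S.coords u l ≈ 0#) → ∀ l → T.coords (F u) l ≈ 0#
      coords-F u e = ++-elim (λ l → T.coords (F u) l ≈ 0#)
        (λ i → begin
          T.coords (F u) (i ↑ˡ m)  ≈⟨ T.coordsˡ (F u) i ⟩
          ω (F u) (z i)            ≈⟨ adjoint u (z i) ⟩
          σ (ω u (V (z i)))        ≈⟨ σ-cong (trans (sym (S.coordsˡ u i)) (e (i ↑ˡ m))) ⟩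
          σ 0#                     ≈⟨ σ-0 ⟩
          0#                       ∎)
        (λ i → trans (T.coordsʳ (F u) i)
          (ω-FF₀ (x i) u (trans (sym (S.coordsʳ u i)) (e (m ↑ʳ i)))))

      -- In these coordinates F is σ followed by the diagonal matrix diag(1, …, 1, p, …, p).
      twist : Vector Z (m ℕ.+ m) → Vector Z (m ℕ.+ m)
      twist a = (λ i → σ (a (i ↑ˡ m))) ++ (λ i → σ (a (m ↑ʳ i)) * p̂)

      F-comb : ∀ a → F (S.comb a) ≈ᴹ T.comb (twist a)
      F-comb a l = trans
        (additive-sum isAdditive (λ i → a (i ↑ˡ m) *ₗ x i +ᴹ a (m ↑ʳ i) *ₗ V (z i)) l)
        (sumᴰ-cong {m} (λ i l → begin
          F (a (i ↑ˡ m) *ₗ x i +ᴹ a (m ↑ʳ i) *ₗ V (z i)) l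
            ≈⟨ F.+-homo _ _ l ⟩
          F (a (i ↑ˡ m) *ₗ x i) l + F (a (m ↑ʳ i) *ₗ V (z i)) l
            ≈⟨ +-cong (semilinear _ (x i) l)
                 (trans (semilinear _ (V (z i)) l) (*-congˡ (FV≈p̂ (z i) l))) ⟩
          σ (a (i ↑ˡ m)) * F (x i) l + σ (a (m ↑ʳ i)) * (p̂ * z i l)
            ≈⟨ +-cong (*-congʳ (reflexive (≡.sym (lookup-++ˡ (λ i → σ (a (i ↑ˡ m))) _ i))))
                 (trans (sym (*-assoc _ _ _))
                   (*-congʳ (reflexive (≡.sym (lookup-++ʳ (λ i → σ (a (i ↑ˡ m))) _ i))))) ⟩
          twist a (i ↑ˡ m) * F (x i) l + twist a (m ↑ʳ i) * z i l ∎) l)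

      -- If F vanished mod p on the orthogonal complement of the system, then so would ω.
      π∼0 : (∀ j → F (S.π (dual j)) ∼ Dᴹ.0ᴹ) → ∀ u → S.π u ∼ Dᴹ.0ᴹ
      -- Self-adjointness of `π` carries divisibility by p from the vectors π(dual j) to every π u.
      π∼0 Fπ∼0 u j = ω u (a j) , (begin
        S.π u j                  ≈⟨ ω-dual (S.π u) j ⟨
        ω (S.π u) (dual j)       ≈⟨ S.π-adjoint u (dual j) ⟩
        ω u (S.π (dual j))       ≈⟨ ω-cong {x = u} (λ _ → refl)
                                      (λ l → trans (proj₂ (πdual∼0 j l)) (+-identityˡ _)) ⟩
        ω u (p̂ *ₗ a j)           ≈⟨ ω-*ʳ p̂ u (a j) ⟩
        p̂ * ω u (a j)            ≈⟨ +-identityˡ _ ⟨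
        0# + p̂ * ω u (a j)       ∎)
        where
        πdual∼0 : ∀ j → S.π (dual j) ∼ Dᴹ.0ᴹ
        -- Entry l of π(dual j) equals ω(π(dual j), π(dual l)), a pairing of two vectors whose
        -- images under F are divisible by p.
        πdual∼0 j l = ≡-trans
          (≈⇒≡ (trans (sym (ω-dual (S.π (dual j)) l))
            (sym (S.ω-πʳ (S.π (dual j)) (S.coords-π (dual j)) (dual l)))))
          -- F contributes a factor p in each argument and `ω-FF` uses up one of them, so one
          -- survives the cancellation.
          (σ-reflects-p (ω (h j) (h l) , p̂-cancel (begin
            p̂ * σ (ω (S.π (dual j)) (S.π (dual l)))  ≈⟨ ω-FF (S.π (dual j)) (S.π (dual l)) ⟨
            ω (F (S.π (dual j))) (F (S.π (dual l)))  ≈⟨ ω-cong (F≈ j) (F≈ l) ⟩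
            ω (p̂ *ₗ h j) (p̂ *ₗ h l)                  ≈⟨ ω-*ˡ p̂ (h j) (p̂ *ₗ h l) ⟩
            p̂ * ω (h j) (p̂ *ₗ h l)                   ≈⟨ *-congˡ (ω-*ʳ p̂ (h j) (h l)) ⟩
            p̂ * (p̂ * ω (h j) (h l))                  ≈⟨ *-congˡ (+-identityˡ _) ⟨
            p̂ * (0# + p̂ * ω (h j) (h l))             ∎)))
          where
          h : Fin (g ℕ.+ g) → D
          h j l = proj₁ (Fπ∼0 j l)
          F≈ : ∀ j → F (S.π (dual j)) ≈ᴹ p̂ *ₗ h j
          F≈ j l = trans (proj₂ (Fπ∼0 j l)) (+-identityˡ _)
        a : Fin (g ℕ.+ g) → D
        a j l = proj₁ (πdual∼0 j l)

      module _ (u v : D) (u⊥ : ∀ l → S.coords u l ≈ 0#) (v⊥ : ∀ l → T.coords v l ≈ 0#)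
               (ω-Fuv : ω (F u) v ≈ 1#) where
        extension : AdaptedSystem (suc m)
        extension = record
          { x = u ∷ x
          ; z = v ∷ z
          ; ω-xx = λ
            { zero    zero    → ω-alternating u
            ; zero    (suc j) → ω-skew₀ (x j) u (trans (sym (S.coordsʳ u j)) (u⊥ (m ↑ʳ j)))
            ; (suc i) zero    → trans (sym (S.coordsʳ u i)) (u⊥ (m ↑ʳ i))
            ; (suc i) (suc j) → ω-xx i j
            }
          ; ω-zz = λ
            { zero    zero    → ω-alternating v
            ; zero    (suc j) → trans (sym (T.coordsˡ v j)) (v⊥ (j ↑ˡ m))
            ; (suc i) zero    → ω-skew₀ v (z i) (trans (sym (T.coordsˡ v i)) (v⊥ (i ↑ˡ m)))
            ; (suc i) (suc j) → ω-zz i j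
            }
          ; ω-Fxz = λ
            { zero    zero    → ω-Fuv
            ; zero    (suc j) → trans (sym (T.coordsˡ (F u) j)) (coords-F u u⊥ (j ↑ˡ m))
            ; (suc i) zero    → trans (sym (T.coordsʳ v i)) (v⊥ (m ↑ʳ i))
            ; (suc i) (suc j) → ω-Fxz i j
            }
          }

    extend : ∀ {m} → m ℕ.< g → AdaptedSystem m → AdaptedSystem (suc m)
    -- Testing the entries of the finitely many vectors F(π(dual j)) makes vanishing mod p decidable
    -- and delivers a witness when it fails.
    extend {m} m<g s = go (any? λ j → any? λ l → ¬? (code (F (S.π (dual j)) l) ≟ code 0#))
      where
      open AdaptedSystem s
      go : _ → AdaptedSystem (suc m)
      -- The entry y l is a unit with inverse b, so `b *ₗ dual l` pairs to 1 with y. Projecting it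
      -- by `T.π` keeps this pairing, because y already lies in the complement of `target`.
      go (yes (j , l , F≁0)) = extension (S.π (dual j)) (T.π (b *ₗ dual l))
          (S.coords-π (dual j)) (T.coords-π (b *ₗ dual l)) (begin
            ω y (T.π (b *ₗ dual l))  ≈⟨ T.ω-πʳ y y⊥ (b *ₗ dual l) ⟩
            ω y (b *ₗ dual l)        ≈⟨ ω-*ʳ b y (dual l) ⟩
            b * ω y (dual l)         ≈⟨ *-congˡ (ω-dual y l) ⟩
            b * y l                  ≈⟨ *-comm b _ ⟩
            y l * b                  ≈⟨ proj₂ unit ⟩
            1#                       ∎)
        where
        y = F (S.π (dual j))
        y⊥ = coords-F (S.π (dual j)) (S.coords-π (dual j))
        unit = inverse {y l} (λ e → F≁0 (code-cong e))
        b = proj₁ unit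
      go (no F∼0) = contradiction
        (π∼0 λ j l → code-injective (decidable-stable (_ ≟ _) λ F≁0 → F∼0 (j , l , F≁0)))
        (¬spanning-mod-p source m<g)

    adapted : ∀ m → m ℕ.≤ g → AdaptedSystem m
    adapted zero    _   = record { x = λ () ; z = λ () ; ω-xx = λ () ; ω-zz = λ () ; ω-Fxz = λ () }
    adapted (suc m) m<g = extend m<g (adapted m (ℕ.<⇒≤ m<g))

    open AdaptedSystem (adapted g ℕ.≤-refl) public using (source; target; twist; F-comb)

  -- Inverses of symplectic maps and the two inclusions.

  module Symplectic {h : D → D} (symplectic : IsSymplectic h) where
    open IsSymplectic symplectic
    open LeftModuleMorphisms Dᴹ.rawLeftModule Dᴹ.rawLeftModule using (module IsLeftModuleIsomorphism)
    open IsLeftModuleIsomorphism isLeftModuleIsomorphism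
      using (⟦⟧-cong; +ᴹ-homo; *ₗ-homo; injective; surjective)

    linear : IsLinear h
    linear = record { cong = ⟦⟧-cong ; +-homo = +ᴹ-homo ; *-homo = *ₗ-homo }

    h⁻¹ : D → D
    h⁻¹ u = proj₁ (surjective u)

    h∘h⁻¹ : ∀ u → h (h⁻¹ u) ≈ᴹ u
    h∘h⁻¹ u = proj₂ (surjective u) (λ _ → refl)

    h⁻¹∘h : ∀ u → h⁻¹ (h u) ≈ᴹ u
    h⁻¹∘h u = injective (h∘h⁻¹ (h u))

    -- Surjectivity merely chooses preimages; injectivity of h makes the choice respect equality and
    -- the module structure.
    h⁻¹-linear : IsLinear h⁻¹
    h⁻¹-linear = record
      { cong   = λ {u} {v} e → injective λ l → trans (h∘h⁻¹ u l) (trans (e l) (sym (h∘h⁻¹ v l)))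
      ; +-homo = λ u v → injective λ l → trans (h∘h⁻¹ (u +ᴹ v) l) (sym (trans
          (+ᴹ-homo (h⁻¹ u) (h⁻¹ v) l) (+-cong (h∘h⁻¹ u l) (h∘h⁻¹ v l))))
      ; *-homo = λ a u → injective λ l → trans (h∘h⁻¹ (a *ₗ u) l) (sym (trans
          (*ₗ-homo a (h⁻¹ u) l) (*-congˡ (h∘h⁻¹ u l))))
      }

    adjoint : ∀ u v → ω (h u) v ≈ ω u (h⁻¹ v)
    adjoint u v = trans
      (ω-cong {x = h u} (λ _ → refl) (λ l → sym (h∘h⁻¹ v l))) (preserves-ω u (h⁻¹ v))

  -- The ω-adjoint of a symplectic map is its inverse, so the dual of h F₀ h′ is h′⁻¹ V₀ h⁻¹.
  ∈Sp⇒autodual : (F₀ F : D → D) → IsPAutodual F₀ → F ∈Sp F₀ Sp → IsPAutodual F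
  ∈Sp⇒autodual F₀ F F₀-autodual (h , h′ , h-symplectic , h′-symplectic , F≈) = record
    { isSemilinear = record
      { isAdditive = record
        { cong   = λ {u} {v} e l → begin
            F u l             ≈⟨ F≈ u l ⟩
            h (F₀ (h′ u)) l   ≈⟨ H.cong (F₀.F.cong (H′.cong e)) l ⟩
            h (F₀ (h′ v)) l   ≈⟨ F≈ v l ⟨
            F v l             ∎
        ; +-homo = λ u v l → begin
            F (u +ᴹ v) l                        ≈⟨ F≈ (u +ᴹ v) l ⟩
            h (F₀ (h′ (u +ᴹ v))) l              ≈⟨ H.cong (F₀.F.cong (H′.+-homo u v)) l ⟩
            h (F₀ (h′ u +ᴹ h′ v)) l             ≈⟨ H.cong (F₀.F.+-homo (h′ u) (h′ v)) l ⟩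
            h (F₀ (h′ u) +ᴹ F₀ (h′ v)) l        ≈⟨ H.+-homo (F₀ (h′ u)) (F₀ (h′ v)) l ⟩
            h (F₀ (h′ u)) l + h (F₀ (h′ v)) l   ≈⟨ +-cong (F≈ u l) (F≈ v l) ⟨
            F u l + F v l                       ∎
        }
      ; semilinear = λ a u l → begin
          F (a *ₗ u) l                ≈⟨ F≈ (a *ₗ u) l ⟩
          h (F₀ (h′ (a *ₗ u))) l      ≈⟨ H.cong (F₀.F.cong (H′.*-homo a u)) l ⟩
          h (F₀ (a *ₗ h′ u)) l        ≈⟨ H.cong (F₀.semilinear a (h′ u)) l ⟩
          h (σ a *ₗ F₀ (h′ u)) l      ≈⟨ H.*-homo (σ a) (F₀ (h′ u)) l ⟩
          σ a * h (F₀ (h′ u)) l       ≈⟨ *-congˡ (F≈ u l) ⟨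
          σ a * F u l                 ∎
      }
    ; V = V
    ; isInverseSemilinear = record
      { isAdditive = record
        { cong   = λ e → H′⁻¹.cong (F₀.V.cong (H⁻¹.cong e))
        ; +-homo = λ u v l → begin
            V (u +ᴹ v) l                          ≈⟨ H′⁻¹.cong (F₀.V.cong (H⁻¹.+-homo u v)) l ⟩
            h′⁻¹ (F₀.V (h⁻¹ u +ᴹ h⁻¹ v)) l        ≈⟨ H′⁻¹.cong (F₀.V.+-homo (h⁻¹ u) (h⁻¹ v)) l ⟩
            h′⁻¹ (F₀.V (h⁻¹ u) +ᴹ F₀.V (h⁻¹ v)) l ≈⟨ H′⁻¹.+-homo (F₀.V (h⁻¹ u)) (F₀.V (h⁻¹ v)) l ⟩
            V u l + V v l                         ∎
        }
      ; semilinear = λ a u l → begin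
          V (σ a *ₗ u) l                      ≈⟨ H′⁻¹.cong (F₀.V.cong (H⁻¹.*-homo (σ a) u)) l ⟩
          h′⁻¹ (F₀.V (σ a *ₗ h⁻¹ u)) l        ≈⟨ H′⁻¹.cong (F₀.V-semilinear a (h⁻¹ u)) l ⟩
          h′⁻¹ (a *ₗ F₀.V (h⁻¹ u)) l          ≈⟨ H′⁻¹.*-homo a (F₀.V (h⁻¹ u)) l ⟩
          a * V u l                           ∎
      }
    ; F∘V≈p = λ u l → begin
        F (V u) l                       ≈⟨ F≈ (V u) l ⟩
        h (F₀ (h′ (V u))) l             ≈⟨ H.cong (F₀.F.cong (Sh′.h∘h⁻¹ (F₀.V (h⁻¹ u)))) l ⟩
        h (F₀ (F₀.V (h⁻¹ u))) l         ≈⟨ H.cong (F₀.FV≈p̂ (h⁻¹ u)) l ⟩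
        h (p̂ *ₗ h⁻¹ u) l                ≈⟨ H.*-homo p̂ (h⁻¹ u) l ⟩
        p̂ * h (h⁻¹ u) l                 ≈⟨ *-congˡ (Sh.h∘h⁻¹ u l) ⟩
        p̂ * u l                         ≈⟨ ×≈*ₗ p u l ⟨
        _                               ∎
    ; V∘F≈p = λ u l → begin
        V (F u) l                               ≈⟨ H′⁻¹.cong (F₀.V.cong (H⁻¹.cong (F≈ u))) l ⟩
        h′⁻¹ (F₀.V (h⁻¹ (h (F₀ (h′ u))))) l     ≈⟨ H′⁻¹.cong (F₀.V.cong (Sh.h⁻¹∘h (F₀ (h′ u)))) l ⟩
        h′⁻¹ (F₀.V (F₀ (h′ u))) l               ≈⟨ H′⁻¹.cong (F₀.VF≈p̂ (h′ u)) l ⟩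
        h′⁻¹ (p̂ *ₗ h′ u) l                      ≈⟨ H′⁻¹.*-homo p̂ (h′ u) l ⟩
        p̂ * h′⁻¹ (h′ u) l                       ≈⟨ *-congˡ (Sh′.h⁻¹∘h u l) ⟩
        p̂ * u l                                 ≈⟨ ×≈*ₗ p u l ⟨
        _                                       ∎
    ; adjoint = λ u v → begin
        ω (F u) v                       ≈⟨ ω-cong {y = v} (F≈ u) (λ _ → refl) ⟩
        ω (h (F₀ (h′ u))) v             ≈⟨ Sh.adjoint (F₀ (h′ u)) v ⟩
        ω (F₀ (h′ u)) (h⁻¹ v)           ≈⟨ F₀.adjoint (h′ u) (h⁻¹ v) ⟩
        σ (ω (h′ u) (F₀.V (h⁻¹ v)))     ≈⟨ σ-cong (Sh′.adjoint u (F₀.V (h⁻¹ v))) ⟩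
        σ (ω u (V v))                   ∎
    }
    where
    module F₀ = Autodual F₀-autodual
    module Sh = Symplectic h-symplectic
    module Sh′ = Symplectic h′-symplectic
    module H = IsLinear Sh.linear
    module H′ = IsLinear Sh′.linear
    module H⁻¹ = IsLinear Sh.h⁻¹-linear
    module H′⁻¹ = IsLinear Sh′.h⁻¹-linear
    open Sh using (h⁻¹)
    open Sh′ using () renaming (h⁻¹ to h′⁻¹)
    V : D → D
    V = h′⁻¹ ∘ F₀.V ∘ h⁻¹

  autodual⇒∈Sp : (F₀ F : D → D) → IsPAutodual F₀ → IsPAutodual F → F ∈Sp F₀ Sp
  autodual⇒∈Sp F₀ F F₀-autodual F-autodual =
    changeBasis A₀.target A.target , changeBasis A.source A₀.source ,
    changeBasis-symplectic A₀.target A.target (spanning A₀.target) (spanning A.target) ,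
    changeBasis-symplectic A.source A₀.source (spanning A.source) (spanning A₀.source) ,
    λ u l → begin
      F u l
        ≈⟨ A.F.cong (spanning A.source u) l ⟨
      F (S.comb (S.coords u)) l
        ≈⟨ A.F-comb (S.coords u) l ⟩
      T.comb (A.twist (S.coords u)) l
        -- `A.twist` and `A₀.twist` are the same function, depending only on σ and p: in adapted
        -- bases F and F₀ have the same matrix.
        ≈⟨ IsLinear.cong T.comb-linear (T₀.coords-comb (A₀.twist (S.coords u))) l ⟨
      T.comb (T₀.coords (T₀.comb (A₀.twist (S.coords u)))) l
        ≈⟨ IsLinear.cong (∘-linear T₀.coords-linear T.comb-linear) (A₀.F-comb (S.coords u)) l ⟨
      T.comb (T₀.coords (F₀ (S₀.comb (S.coords u)))) l ∎
    where
    module A₀ = Autodual F₀-autodual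
    module A = Autodual F-autodual
    module S = HyperbolicSystem A.source
    module T = HyperbolicSystem A.target
    module S₀ = HyperbolicSystem A₀.source
    module T₀ = HyperbolicSystem A₀.target

-- Characteristic and Frobenius of a finite field.

module Exponentiation (A : CommutativeRing c ℓ) where
  open CommutativeRing A hiding (zero)
  open import Algebra.Properties.Semiring.Exp semiring using () renaming (_^_ to _^ᴬ_)

  0^n≈0 : ∀ n → .{{NonZero n}} → 0# ^ᴬ n ≈ 0#
  0^n≈0 (suc n) = zeroˡ _

module FiniteField (k : CommutativeRing c ℓ) {p r : ℕ} (prime : Prime p)
                   (finite : IsFiniteField k (p ^ r)) where
  open CommutativeRing k hiding (zero)
  open IsFiniteField finite
  open Inverse enumeration using (to; from; to-cong; from-cong; strictlyInverseˡ; strictlyInverseʳ)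
  open Congruence k using (freshman)
  open Exponentiation k
  open import Algebra.Properties.CommutativeSemiring.Exp commutativeSemiring
    using (^-congˡ; ^-distrib-*) renaming (_^_ to _^ᵏ_)
  open import Algebra.Properties.Semiring.Mult semiring using (×1-homo-*) renaming (_×_ to _·_)
  open import Algebra.Properties.Semiring.Sum semiring
    using (sum; sum-cong-≋; sum-permute; ∑-distrib-+; sum-replicate)
  open import Algebra.Properties.Group +-group
    using (identityʳ-unique; inverseʳ-unique; x∙y⁻¹≈ε⇒x≈y)
  open import Relation.Binary.Reasoning.Setoid setoid

  private
    q = p ^ r

    instance
      _ : NonZero p
      _ = prime⇒nonZero prime

  injective : ∀ {x y} → to x ≡ to y → x ≈ y
  injective {x} {y} e = trans (sym (strictlyInverseʳ x)) (trans (from-cong e) (strictlyInverseʳ y))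

  infix 4 _≈?_
  _≈?_ : Decidable _≈_
  x ≈? y = map′ injective to-cong (to x ≟ to y)

  -- Translation by 1 permutes k, hence does not change the sum of all elements.
  q·1≈0 : q · 1# ≈ 0#
  q·1≈0 = identityʳ-unique (sum from) (q · 1#) (begin
    sum from + q · 1#                 ≈⟨ +-congˡ (sum-replicate q) ⟨
    sum from + sum {q} (λ _ → 1#)     ≈⟨ ∑-distrib-+ from (λ _ → 1#) ⟨
    sum (λ i → from i + 1#)           ≈⟨ sum-cong-≋ {q} (λ i → strictlyInverseʳ (from i + 1#)) ⟨
    sum (λ i → from (to (from i + 1#))) ≈⟨ sum-permute from translation ⟨
    sum from                          ∎)
    where
    shift : ∀ a b → a + b ≈ 0# → ∀ i → to (from (to (from i + a)) + b) ≡ i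
    shift a b e i = ≡.trans (to-cong (begin
      from (to (from i + a)) + b  ≈⟨ +-congʳ (strictlyInverseʳ _) ⟩
      from i + a + b              ≈⟨ +-assoc _ _ _ ⟩
      from i + (a + b)            ≈⟨ +-congˡ e ⟩
      from i + 0#                 ≈⟨ +-identityʳ _ ⟩
      from i                      ∎)) (strictlyInverseˡ i)
    translation = permutation (λ i → to (from i + 1#)) (λ i → to (from i + - 1#))
      (shift (- 1#) 1# (-‿inverseˡ 1#)) (shift 1# (- 1#) (-‿inverseʳ 1#))

  integral : ∀ x y → ¬ x ≈ 0# → x * y ≈ 0# → y ≈ 0#
  integral x y x≉0 e = let x⁻¹ , inv = inverse x x≉0 in begin
    y               ≈⟨ *-identityˡ y ⟨
    1# * y          ≈⟨ *-congʳ (trans (*-comm x⁻¹ x) inv) ⟨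
    x⁻¹ * x * y     ≈⟨ *-assoc _ _ _ ⟩
    x⁻¹ * (x * y)   ≈⟨ *-congˡ e ⟩
    x⁻¹ * 0#        ≈⟨ zeroʳ _ ⟩
    0#              ∎

  x^n≈0⇒x≈0 : ∀ x n → x ^ᵏ n ≈ 0# → x ≈ 0#
  x^n≈0⇒x≈0 x zero    e = contradiction e 1≉0
  x^n≈0⇒x≈0 x (suc n) e with x ≈? 0#
  ... | yes x≈0 = x≈0
  ... | no  x≉0 = x^n≈0⇒x≈0 x n (integral x _ x≉0 e)

  -- `IsFiniteField` records only the number of elements. The characteristic follows from (p·1)ʳ =
  -- q·1 = 0, as a field has no nilpotents.
  p·1≈0 : p · 1# ≈ 0#
  p·1≈0 = x^n≈0⇒x≈0 (p · 1#) r (trans (sym (power r)) q·1≈0)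
    where
    power : ∀ n → (p ^ n) · 1# ≈ (p · 1#) ^ᵏ n
    power zero    = +-identityʳ 1#
    power (suc n) = trans (×1-homo-* p (p ^ n)) (*-congˡ (power n))

  frob : Carrier → Carrier
  frob x = x ^ᵏ p

  frob-+ : ∀ x y → frob (x + y) ≈ frob x + frob y
  frob-+ x y = let h , e = freshman prime x y in
    trans e (trans (+-congˡ (trans (*-congʳ p·1≈0) (zeroˡ h))) (+-identityʳ _))

  -- Deduced from additivity, which spares a case distinction on the parity of p.
  frob-neg : ∀ x → frob (- x) ≈ - frob x
  frob-neg x = inverseʳ-unique (frob x) (frob (- x))
    (trans (sym (frob-+ x (- x))) (trans (^-congˡ p (-‿inverseʳ x)) (0^n≈0 p)))

  frob-hom : RawHom rawRing rawRing
  frob-hom = record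
    { fun           = frob
    ; isEquivalence = isEquivalence
    ; +-cong        = +-cong
    ; *-cong        = *-cong
    ; -‿cong        = -‿cong
    ; 0-homo        = 0^n≈0 p
    ; 1-homo        = 1^ p
    ; +-homo        = frob-+
    ; *-homo        = λ x y → ^-distrib-* x y p
    ; -‿homo        = frob-neg
    }
    where
    1^ : ∀ n → 1# ^ᵏ n ≈ 1#
    1^ zero    = refl
    1^ (suc n) = trans (*-identityˡ _) (1^ n)

  frob-injective : ∀ {x y} → frob x ≈ frob y → x ≈ y
  frob-injective {x} {y} e = x∙y⁻¹≈ε⇒x≈y x y (x^n≈0⇒x≈0 (x - y) p (begin
    frob (x - y)        ≈⟨ frob-+ x (- y) ⟩
    frob x + frob (- y) ≈⟨ +-cong e (frob-neg y) ⟩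
    frob y - frob y     ≈⟨ -‿inverseʳ _ ⟩
    0#                  ∎))

  frob-surjective : ∀ x → ∃ λ y → frob y ≈ x
  frob-surjective x = let i , e = preimage in from i , injective e
    where
    preimage = injective⇒surjective (to ∘ frob ∘ from)
      (λ {i} {j} e → ≡.trans (≡.sym (strictlyInverseˡ i))
        (≡.trans (to-cong (frob-injective (injective e))) (strictlyInverseˡ j)))
      (to x)

-- Verschiebung, Teichmüller representatives and multiplication by p.

module WittProperties {p : ℕ} (prime : Prime p) where
  open Witt prime

  private instance
    p≢0 : NonZero p
    p≢0 = prime⇒nonZero prime

  -- The first argument of verschiebung and teichmüller is the zero of X.
  verschiebung : ∀ {a} {X : Set a} → X → (ℕ → X) → ℕ → X
  verschiebung o x zero    = o
  verschiebung o x (suc n) = x n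

  teichmüller : ∀ {a} {X : Set a} → X → X → ℕ → X
  teichmüller o x zero    = x
  teichmüller o x (suc n) = o

  module _ (A : CommutativeRing c ℓ) where
    open CommutativeRing A hiding (zero)
    open Ghost A
    open Exponentiation A
    open import Algebra.Properties.Semiring.Exp semiring using () renaming (_^_ to _^ᴬ_)
    open import Algebra.Properties.Semiring.Mult semiring using () renaming (_×_ to _·_)
    open import Algebra.Properties.Group +-group using (identityʳ-unique)
    private
      module W = CommutativeRing (𝕎 A)
      open import Algebra.Properties.Semiring.Mult W.semiring using () renaming (_×_ to _·ᵂ_)

    -- `ghost-hom` covers ℤ; over any A the identity defining the Witt polynomials is transferred
    -- and evaluated.
    ghost-+ : ∀ n x y → ghost n (x W.+ y) ≈ ghost n x + ghost n y
    ghost-+ n x y = trans (sym (ghost-homo ℤ[ _ ] A evaluate n wittAdd)) (trans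
      (Transfer.transfer A (ghost-wittAdd n) (pair x y))
      (+-cong (ghost-homo ℤ[ _ ] A evaluate n (λ i → var (0F , i)))
              (ghost-homo ℤ[ _ ] A evaluate n (λ i → var (1F , i)))))
      where evaluate = Transfer.evaluate A (pair x y)

    ghost-* : ∀ n x y → ghost n (x W.* y) ≈ ghost n x * ghost n y
    ghost-* n x y = trans (sym (ghost-homo ℤ[ _ ] A evaluate n wittMul)) (trans
      (Transfer.transfer A (ghost-wittMul n) (pair x y))
      (*-cong (ghost-homo ℤ[ _ ] A evaluate n (λ i → var (0F , i)))
              (ghost-homo ℤ[ _ ] A evaluate n (λ i → var (1F , i)))))
      where evaluate = Transfer.evaluate A (pair x y)

    ghost-0 : ∀ n → ghost n W.0# ≈ 0#
    ghost-0 n = identityʳ-unique _ _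
      (trans (sym (ghost-+ n W.0# W.0#)) (ghost-cong n (W.+-identityˡ W.0#)))

    ghost-· : ∀ n m x → ghost n (m ·ᵂ x) ≈ m · 1# * ghost n x
    ghost-· n zero    x = trans (ghost-0 n) (sym (zeroˡ _))
    ghost-· n (suc m) x = trans (ghost-+ n x (m ·ᵂ x)) (trans
      (+-cong (sym (*-identityˡ _)) (ghost-· n m x)) (sym (distribʳ _ _ _)))

    ghost-verschiebung : ∀ n x → ghost (suc n) (verschiebung 0# x) ≈ p̂ * ghost n x
    ghost-verschiebung n x = trans (ghost-suc n (verschiebung 0# x))
      (trans (+-congʳ (0^n≈0 (p ^ suc n) {{ℕ.m^n≢0 p (suc n)}})) (+-identityˡ _))

    ghost-teichmüller : ∀ n x → ghost n (teichmüller 0# x) ≈ x ^ᴬ (p ^ n)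
    ghost-teichmüller zero    x = trans (ghost-zero (teichmüller 0# x)) (sym (*-identityʳ x))
    ghost-teichmüller (suc n) x = trans (ghost-suc n (teichmüller 0# x))
      (trans (+-congˡ (trans (*-congˡ (ghost-0 n)) (zeroʳ p̂))) (+-identityʳ _))

    +-head : ∀ x y → (x W.+ y) 0 ≈ x 0 + y 0
    +-head x y = trans (sym (ghost-zero (x W.+ y)))
      (trans (ghost-+ 0 x y) (+-cong (ghost-zero x) (ghost-zero y)))

    *-head : ∀ x y → (x W.* y) 0 ≈ x 0 * y 0
    *-head x y = trans (sym (ghost-zero (x W.* y)))
      (trans (ghost-* 0 x y) (*-cong (ghost-zero x) (ghost-zero y)))

    -- The recursion `ghost-suc` is this decomposition read on ghost components.
    decompose-ghost : ∀ n x →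
      ghost n (teichmüller 0# (x 0) W.+ verschiebung 0# (x ∘ suc)) ≈ ghost n x
    decompose-ghost zero    x = trans
      (ghost-zero (teichmüller 0# (x 0) W.+ verschiebung 0# (x ∘ suc)))
      (trans (+-head (teichmüller 0# (x 0)) (verschiebung 0# (x ∘ suc)))
        (trans (+-identityʳ _) (sym (ghost-zero x))))
    decompose-ghost (suc n) x = trans
      (ghost-+ (suc n) (teichmüller 0# (x 0)) (verschiebung 0# (x ∘ suc)))
      (trans (+-cong (ghost-teichmüller (suc n) (x 0)) (ghost-verschiebung n (x ∘ suc)))
        (sym (ghost-suc n x)))

  private
    generic : ℕ → Poly (Fin 1 × ℕ)
    generic i = var (0F , i)

    module 𝕎P = CommutativeRing (𝕎 ℤ[ Fin 1 × ℕ ])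

  -- Both sides have the same ghost components, which suffices over ℤ and hence over ℤ[X₀, X₁, …].
  decompose-generic : ∀ n →
    (teichmüller :0 (generic 0) 𝕎P.+ verschiebung :0 (generic ∘ suc)) n ≐ generic n
  decompose-generic n = pointwise at-ρ
    where
    module 𝕎ℤ = CommutativeRing (𝕎 ℤ.+-*-commutativeRing)
    at-ρ : ∀ ρ →
      ⟦ (teichmüller :0 (generic 0) 𝕎P.+ verschiebung :0 (generic ∘ suc)) n ⟧ℤ ρ ≡ ρ (0F , n)
    at-ρ ρ = ≡.trans
      (+-homo (teichmüller :0 (generic 0)) (verschiebung :0 (generic ∘ suc)) n) (≡.trans
      (𝕎ℤ.+-cong {eval ∘ teichmüller :0 (generic 0)} {teichmüller ℤ.0ℤ (x 0)}
                 {eval ∘ verschiebung :0 (generic ∘ suc)} {verschiebung ℤ.0ℤ (x ∘ suc)}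
        (λ { zero → ≡.refl ; (suc i) → ≡.refl }) (λ { zero → ≡.refl ; (suc i) → ≡.refl }) n)
      (ghost-inj n {teichmüller ℤ.0ℤ (x 0) 𝕎ℤ.+ verschiebung ℤ.0ℤ (x ∘ suc)} {x} λ m →
        decompose-ghost ℤ.+-*-commutativeRing m x))
      where
      evaluate = Transfer.evaluate ℤ.+-*-commutativeRing ρ
      eval = RawHom.fun evaluate
      open RawHom (map-hom ℤ.+-*-commutativeRing evaluate) using (+-homo)
      x : ℕ → ℤ
      x i = ρ (0F , i)

  module _ (A : CommutativeRing c ℓ) where
    open CommutativeRing A hiding (zero)
    private
      module W = CommutativeRing (𝕎 A)

    -- Ghost components over A need not determine x, so the generic identity over ℤ[X₀, X₁, ...] is
    -- specialised instead.
    decompose : ∀ x → x W.≈ teichmüller 0# (x 0) W.+ verschiebung 0# (x ∘ suc)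
    decompose x n = trans (sym (Transfer.transfer A (decompose-generic n) (single x)))
      (trans (+-homo (teichmüller :0 (generic 0)) (verschiebung :0 (generic ∘ suc)) n)
        (W.+-cong {eval ∘ teichmüller :0 (generic 0)} {teichmüller 0# (x 0)}
                  {eval ∘ verschiebung :0 (generic ∘ suc)} {verschiebung 0# (x ∘ suc)}
          (λ { zero → refl ; (suc i) → refl }) (λ { zero → refl ; (suc i) → refl }) n))
      where
      eval = RawHom.fun (Transfer.evaluate A (single x))
      open RawHom (map-hom A (Transfer.evaluate A (single x))) using (+-homo)

  module _ {Var : Set} where
    private
      module P = CommutativeRing ℤ[ Var ]
    open Ghost ℤ[ Var ]
    open Congruence ℤ[ Var ]
    open import Algebra.Properties.Semiring.Exp P.semiring using () renaming (_^_ to _^ᴾ_)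

    ≡-cancel : ∀ {f g m} → p̂ :* f ≡ p̂ :* g [mod p̂ :* m ] → f ≡ g [mod m ]
    ≡-cancel {f} {g} {m} (h , e) = h , p̂-cancel (P.trans e
      (P.trans (P.+-congˡ (P.*-assoc p̂ m h)) (P.sym (P.distribˡ p̂ g (m :* h)))))

    -- The heads agree mod p, so their pⁿ⁺¹-th powers agree mod pⁿ⁺². Subtracting these from the
    -- ghost components and cancelling p leaves the same hypothesis for the shifted sequences.
    ghost-≡⇒≡ : ∀ a b → (∀ n → ghost n a ≡ ghost n b [mod p̂ ^ᴾ suc n ]) → ∀ n → a n ≡ b n [mod p̂ ]
    ghost-≡⇒≡ a b e zero = ≡-weaken 0 (≡-trans
      (≈⇒≡ (P.sym (ghost-zero a))) (≡-trans (e 0) (≈⇒≡ (ghost-zero b))))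
    ghost-≡⇒≡ a b e (suc n) = ghost-≡⇒≡ (a ∘ suc) (b ∘ suc) (λ n → ≡-cancel (≡-trans
        (≈⇒≡ (rearrange (ghost-suc n a))) (≡-trans
          (≡-+ (e (suc n)) (≡-neg (≡-^p^ (suc n) (ghost-≡⇒≡ a b e 0))))
          (≈⇒≡ (P.sym (rearrange (ghost-suc n b))))))) n
      where
      rearrange : ∀ {x y z} → x ≐ y :+ z → z ≐ x :+ :- y
      rearrange {x} {y} {z} e = P.sym (P.trans (P.+-congʳ (P.trans e (P.+-comm y z)))
        (P.trans (P.+-assoc z y (:- y)) (P.trans (P.+-congˡ (P.-‿inverseʳ y)) (P.+-identityʳ z))))

  module _ where
    private
      P = ℤ[ Fin 1 × ℕ ]
      module P = CommutativeRing P
      open import Algebra.Properties.Semiring.Mult 𝕎P.semiring using () renaming (_×_ to _·ᵂ_)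
      open import Algebra.Properties.Semiring.Exp P.semiring using () renaming (_^_ to _^ᴾ_)
    open Ghost P
    open Congruence P

    -- wₙ₊₁(p X) = p wₙ₊₁(X) ≡ p wₙ(Xᵖ) = wₙ₊₁(V(Xᵖ)) mod pⁿ⁺², where w denotes ghost components.
    p·generic : ∀ n → (p ·ᵂ generic) n ≡ verschiebung :0 (λ i → generic i ^ᴾ p) n [mod p̂ ]
    p·generic = ghost-≡⇒≡ (p ·ᵂ generic) (verschiebung :0 (λ i → generic i ^ᴾ p)) λ
      { zero    → ghost 0 generic , P.trans (ghost-· P 0 p generic) (P.sym (P.trans
          (P.+-congʳ (ghost-zero (verschiebung :0 (λ i → generic i ^ᴾ p)))) (P.trans (P.+-identityˡ _)
            (P.*-congʳ (P.*-identityʳ p̂)))))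
      ; (suc n) → ≡-trans (≈⇒≡ (ghost-· P (suc n) p generic)) (≡-trans
          (≡-scale p̂ (ghost-frobenius n generic))
          (≈⇒≡ (P.sym (ghost-verschiebung P n (λ i → generic i ^ᴾ p)))))
      }

  module _ (k : CommutativeRing c ℓ) where
    open CommutativeRing k hiding (zero)
    open import Algebra.Properties.Semiring.Mult semiring using () renaming (_×_ to _·_)
    open import Algebra.Properties.Semiring.Exp semiring using () renaming (_^_ to _^ᵏ_)
    private
      module W = CommutativeRing (𝕎 k)
      open import Algebra.Properties.Semiring.Mult W.semiring using () renaming (_×_ to _·ᵂ_)
      open import Algebra.Properties.Semiring.Mult 𝕎P.semiring using () renaming (_×_ to _·ᴾ_)
      open import Algebra.Properties.Semiring.Exp (CommutativeRing.semiring ℤ[ Fin 1 × ℕ ])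
        using () renaming (_^_ to _^ᴾ_)

    -- The classical identity p = VF in characteristic p: evaluation at x annihilates the error term
    -- of `p·generic`, a multiple of p.
    p·-verschiebung : p · 1# ≈ 0# → ∀ x → (p ·ᵂ x) W.≈ verschiebung 0# (frobenius k x)
    p·-verschiebung p≈0 x n = trans (sym (·-homo p n)) (trans
      (Transfer.transfer k (proj₂ (p·generic n)) (single x))
      (trans (+-cong (versch n)
          (trans (*-congʳ (trans (·1-homo ℤ[ _ ] k evaluate p) p≈0)) (zeroˡ _)))
        (+-identityʳ _)))
      where
      evaluate = Transfer.evaluate k (single x)
      eval = RawHom.fun evaluate
      open RawHom (map-hom k evaluate) using (+-homo; 0-homo)
      ·-homo : ∀ m → (eval ∘ (m ·ᴾ generic)) W.≈ (m ·ᵂ x)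
      ·-homo zero    = 0-homo
      ·-homo (suc m) n = trans (+-homo generic (m ·ᴾ generic) n)
        (W.+-cong {eval ∘ generic} {x} {eval ∘ (m ·ᴾ generic)} {m ·ᵂ x} (λ _ → refl) (·-homo m) n)
      versch : ∀ n →
        eval (verschiebung :0 (λ i → generic i ^ᴾ p) n) ≈ verschiebung 0# (frobenius k x) n
      versch zero    = refl
      versch (suc n) = ^-homo ℤ[ _ ] k evaluate (generic n) p

-- The Witt vectors of a finite field.

module FiniteFieldWitt (k : CommutativeRing c ℓ) {p r : ℕ} (prime : Prime p)
                       (finite : IsFiniteField k (p ^ r)) where
  open Witt prime using (𝕎; frobenius; map-hom)
  open WittProperties prime
  open FiniteField k {r = r} prime finite
  open IsFiniteField finite using (1≉0; enumeration) renaming (inverse to inverseᵏ)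
  private
    module k = CommutativeRing k
    module E = Inverse enumeration
    module Frob = RawHom (map-hom k frob-hom)
  open CommutativeRing (𝕎 k) hiding (zero)
  open Congruence (𝕎 k)
  open import Algebra.Properties.Ring ring using (-‿distribʳ-*; -‿+-comm)
  open import Algebra.Properties.AbelianGroup +-abelianGroup using (x∙y⁻¹≈ε⇒x≈y; xyx⁻¹≈y)
  open import Algebra.Properties.CommutativeSemigroup *-commutativeSemigroup using (x∙yz≈y∙xz)
  open import Algebra.Properties.Semiring.Mult semiring using (×-assoc-*; ×-congʳ) renaming (_×_ to _·_)
  open import Algebra.Properties.Semiring.Exp semiring using () renaming (_^_ to _^ᵂ_)
  open import Relation.Binary.Reasoning.Setoid setoid

  frob-cong : ∀ {x y} → x k.≈ y → frob x k.≈ frob y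
  frob-cong = ^ᵏ-congˡ p
    where
    open import Algebra.Properties.Semiring.Exp k.semiring using ()
      renaming (^-congˡ to ^ᵏ-congˡ)

  p̂ : Carrier
  p̂ = p · 1#

  frobenius⁻¹ : Carrier → Carrier
  frobenius⁻¹ x n = proj₁ (frob-surjective (x n))

  p̂*-verschiebung : ∀ x → p̂ * x ≈ verschiebung k.0# (frobenius k x)
  p̂*-verschiebung x = begin
    p̂ * x          ≈⟨ ×-assoc-* p 1# x ⟩
    p · (1# * x)   ≈⟨ ×-congʳ p (*-identityˡ x) ⟩
    p · x          ≈⟨ p·-verschiebung k p·1≈0 x ⟩
    verschiebung k.0# (frobenius k x) ∎

  -- Since k is perfect, a Witt vector with head 0 has the form V(F y) = p y. Hence p generates the
  -- kernel of W(k) → k.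
  p̂*-shift : ∀ x → x 0 k.≈ k.0# → x ≈ p̂ * frobenius⁻¹ (x ∘ suc)
  p̂*-shift x e = trans (λ { zero → e ; (suc n) → k.sym (proj₂ (frob-surjective (x (suc n)))) })
    (sym (p̂*-verschiebung (frobenius⁻¹ (x ∘ suc))))

  p̂-cancel : ∀ {x y} → p̂ * x ≈ p̂ * y → x ≈ y
  p̂-cancel {x} {y} e n = frob-injective (k.trans (k.sym (p̂*-verschiebung x (suc n)))
    (k.trans (e (suc n)) (p̂*-verschiebung y (suc n))))

  -- Each factor p moves the entries one place to the right.
  p̂^*-vanishing : ∀ n x {i} → i ℕ.< n → (p̂ ^ᵂ n * x) i k.≈ k.0#
  p̂^*-vanishing (suc n) x {zero}  _           = k.trans (*-assoc p̂ (p̂ ^ᵂ n) x 0)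
    (p̂*-verschiebung (p̂ ^ᵂ n * x) 0)
  p̂^*-vanishing (suc n) x {suc i} (ℕ.s<s i<n) = k.trans (*-assoc p̂ (p̂ ^ᵂ n) x (suc i)) (k.trans
    (p̂*-verschiebung (p̂ ^ᵂ n * x) (suc i))
    (k.trans (frob-cong (p̂^*-vanishing n x i<n)) (RawHom.0-homo frob-hom)))

  p-separated : ∀ {x} → (∀ n → ∃ λ h → x ≈ p̂ ^ᵂ n * h) → x ≈ 0#
  p-separated d i = k.trans (proj₂ (d (suc i)) i)
    (p̂^*-vanishing (suc i) (proj₁ (d (suc i))) (ℕ.n<1+n i))

  ≡⇒head : ∀ {x y} → x ≡ y [mod p̂ ] → x 0 k.≈ y 0
  ≡⇒head {x} {y} (h , e) = k.trans (e 0) (k.trans (+-head k y (p̂ * h))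
    (k.trans (k.+-congˡ (p̂*-verschiebung h 0)) (k.+-identityʳ _)))

  head⇒≡ : ∀ {x y} → x 0 k.≈ y 0 → x ≡ y [mod p̂ ]
  head⇒≡ {x} {y} e = h , (begin
    x              ≈⟨ xyx⁻¹≈y y x ⟨
    y + x - y      ≈⟨ +-assoc y x (- y) ⟩
    y + (x - y)    ≈⟨ +-congˡ {y} (p̂*-shift (x - y) x-y≈0) ⟩
    y + p̂ * h      ∎)
    where
    h = frobenius⁻¹ ((x - y) ∘ suc)
    x-y≈0 : (x - y) 0 k.≈ k.0#
    x-y≈0 = k.trans (+-head k x (- y)) (k.trans (k.+-congʳ e)
      (k.trans (k.sym (+-head k y (- y))) (-‿inverseʳ y 0)))

  -- a y = t is solved digit by digit: if u inverts a mod p then t - a [u t₀] = p t′, and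
  -- the solution for t is y = [u t₀] + p y′, where y′ is the solution for t′.
  module Division (a : Carrier) (u : k.Carrier) (au≈1 : a 0 k.* u k.≈ k.1#) where
    digit : Carrier → Carrier
    digit t = teichmüller k.0# (u k.* t 0)

    step : ∀ t → t ≡ a * digit t [mod p̂ ]
    step t = head⇒≡ (k.sym (k.trans (*-head k a (digit t)) (k.trans (k.sym (k.*-assoc _ _ _))
      (k.trans (k.*-congʳ au≈1) (k.*-identityˡ _)))))

    next : Carrier → Carrier
    next t = proj₁ (step t)

    solution : Carrier → Carrier
    solution t zero    = u k.* t 0
    -- Adding p y′ to a Teichmüller digit places the entries of y′, raised to the p-th power, behind
    -- that digit. The infinite expansion is thus defined entry by entry, without a limit.
    solution t (suc n) = frob (solution (next t) n)

    solution-step : ∀ t → solution t ≈ digit t + p̂ * solution (next t)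
    solution-step t = trans (decompose k (solution t))
      (+-congˡ {digit t} (sym (p̂*-verschiebung (solution (next t)))))

    error : Carrier → Carrier
    error t = t - a * solution t

    error-step : ∀ t → error t ≈ p̂ * error (next t)
    error-step t = begin
      t - a * solution t
        ≈⟨ +-cong (proj₂ (step t))
             (-‿cong (trans (*-congˡ {a} (solution-step t)) (distribˡ a (digit t) _))) ⟩
      (x + p̂ * t′) - (x + a * (p̂ * y′))
        ≈⟨ +-cong (+-comm x (p̂ * t′)) (sym (-‿+-comm x (a * (p̂ * y′)))) ⟩
      (p̂ * t′ + x) + (- x - a * (p̂ * y′))
        ≈⟨ +-assoc _ _ _ ⟩
      p̂ * t′ + (x + (- x - a * (p̂ * y′)))
        ≈⟨ +-congˡ {p̂ * t′} (trans (sym (+-assoc x (- x) _))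
             (trans (+-congʳ (-‿inverseʳ x)) (+-identityˡ _))) ⟩
      p̂ * t′ - a * (p̂ * y′)
        ≈⟨ +-congˡ {p̂ * t′} (trans (-‿cong (x∙yz≈y∙xz a p̂ y′)) (-‿distribʳ-* p̂ (a * y′))) ⟩
      p̂ * t′ + p̂ * - (a * y′)
        ≈⟨ distribˡ p̂ t′ (- (a * y′)) ⟨
      p̂ * (t′ - a * y′) ∎
      where
      x = a * digit t
      t′ = next t
      y′ = solution t′

    error-divisible : ∀ n t → ∃ λ h → error t ≈ p̂ ^ᵂ n * h
    error-divisible zero    t = error t , sym (*-identityˡ (error t))
    error-divisible (suc n) t = let h , e = error-divisible n (next t) in
      h , trans (error-step t) (trans (*-congˡ {p̂} e) (sym (*-assoc p̂ (p̂ ^ᵂ n) h)))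

    solution-correct : ∀ t → a * solution t ≈ t
    solution-correct t = sym (x∙y⁻¹≈ε⇒x≈y t (a * solution t)
      (p-separated λ n → error-divisible n t))

  wittLike : IsWittLike (𝕎 k) (frobenius k) p (p ^ r)
  wittLike = record
    { σ-cong         = λ e n → frob-cong (e n)
    ; σ-+            = Frob.+-homo
    ; σ-*            = Frob.*-homo
    ; σ-1            = Frob.1-homo
    ; σ-injective    = λ e n → frob-injective (e n)
    ; σ-reflects-p   = λ {a} e → head⇒≡
        (frob-injective (k.trans (≡⇒head e) (k.sym (RawHom.0-homo frob-hom))))
    ; p̂-cancel       = p̂-cancel
    ; p-separated    = p-separated
    ; inverse        = λ {a} a≢0 → let u , au≈1 = inverseᵏ (a 0) (λ e → a≢0 (head⇒≡ e)) in
        Division.solution a u au≈1 1# , Division.solution-correct a u au≈1 1#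
    ; code           = λ a → E.to (a 0)
    -- `code` reads only entry 0, so the constant sequence serves as an arbitrary lift.
    ; decode         = λ i _ → E.from i
    ; code-cong      = λ e → E.to-cong (≡⇒head e)
    ; code-injective = λ e → head⇒≡ (injective e)
    ; code-decode    = E.strictlyInverseˡ
    ; 1<N            = distinct⇒1<n (λ e → 1≉0 (injective e))
    }

proposition3p1 : ∀ {c ℓ} {p r g : ℕ} (prime : Prime p) .{{_ : NonZero r}} .{{_ : NonZero g}}
    (k : CommutativeRing c ℓ) → IsFiniteField k (p ^ r) →
    let open SymplecticLattice (Witt.𝕎 prime k) (Witt.frobenius prime k) p g in
    (F₀ : D → D) → IsPAutodual F₀ → (F : D → D) → F ∈Sp F₀ Sp ⇔ IsPAutodual F
proposition3p1 {p = p} {r} {g} p-prime k finite F₀ F₀-autodual F =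
  mk⇔ (∈Sp⇒autodual F₀ F F₀-autodual) (autodual⇒∈Sp F₀ F F₀-autodual)
  where
  open DoubleCoset (Witt.𝕎 p-prime k) (Witt.frobenius p-prime k) p g
    (FiniteFieldWitt.wittLike k {r = r} p-prime finite)
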